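{- Let $N\ge 3$ and $1\le r\le N$, and write $N=qr+s$ with integers $q,s$ and $0\le s<r$. Consider all sets $R$ consisting of $r$ rim vertices of the wheel graph $W_{N+1}$, and let $d_1,\ldots,d_r$ denote the cyclic intervals of $R$. (1) Among all such $R$, the number $\mathcal F_{W_{N+1}}(R)$ is maximized if and only if, in the cyclic interval sequence $(d_1,\ldots,d_r)$, the value $q+1$ appears $s$ times and the value $q$ appears $r-s$ times. The maximum value is $$F_{2(q+1)}^{\,s}F_{2q}^{\,r-s}\left(s\,\frac{L_{2(q+1)}-2}{F_{2(q+1)}}+(r-s)\,\frac{L_{2q}-2}{F_{2q}}\right).$$ (2) Among all such $R$, the number $\mathcal F_{W_{N+1}}(R)$ is minimized if and only if, in $(d_1,\ldots,d_r)$, one cyclic interval is $N-r+1$ and the remaining $r-1$ cyclic intervals are all equal to $1$. The minimum value is $$L_{2(N-r+1)}-2+(r-1)F_{2(N-r+1)}.$$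
   Context: The wheel graph $W_{N+1}$ ($N\ge3$) has vertex set $\{c,v_1,\ldots,v_N\}$ and edges $\{v_i,v_{i+1}\}$ (indices modulo $N$) and $\{c,v_i\}$ for $1\le i\le N$; $c$ is the central vertex and the $v_i$ are the rim vertices. For a set $R=\{v_{a_1},\ldots,v_{a_r}\}$ of rim vertices with $1\le a_1<\cdots<a_r\le N$, the cyclic intervals are $d_i=a_{i+1}-a_i$ for $1\le i\le r-1$ and $d_r=a_1+N-a_r$. For a finite connected graph $G$ and $\varnothing\ne R\subseteq V(G)$, a rooted spanning forest of $G$ with root set $R$ is a spanning forest (an acyclic subgraph containing all vertices of $G$) in which each connected component contains exactly one vertex of $R$; $\mathcal F_G(R)$ denotes the number of such forests. Fibonacci numbers: $F_0=0$, $F_1=1$, $F_{n+2}=F_{n+1}+F_n$. Lucas numbers: $L_0=2$, $L_1=1$, $L_{n+2}=L_{n+1}+L_n$. -}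

module Defs where

open import Data.Empty using (⊥-elim)
open import Data.Fin.Base as Fin using (Fin; zero; suc; toℕ; splitAt)
open import Data.Fin.Properties as Fin using (any?; all?; toℕ<n; toℕ-fromℕ<; splitAt⁻¹-↑ˡ; splitAt⁻¹-↑ʳ)
open import Data.Fin.Subset using (Subset; _∈_; inside; outside)
open import Data.Fin.Subset.Properties using (_∈?_)
open import Data.Integer.Base as ℤ using (+_; _⊖_)
open import Data.List.Base using (List; []; _∷_; _++_; [_]; length; map; filter; allFin; lookup)
open import Data.List.Membership.Propositional.Properties using (∈-lookup)
open import Data.List.Relation.Unary.All as All using (All; []; _∷_)
open import Data.List.Relation.Unary.AllPairs using (allPairs?; []; _∷_)
open import Data.List.Relation.Unary.All.Properties using (¬Any⇒All¬)
open import Data.List.Relation.Unary.Any as Any using (here; there)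
open import Data.List.Relation.Unary.Linked using (Linked; linked?)
open import Data.List.Relation.Unary.Unique.Propositional using (Unique)
import Data.List.Membership.Propositional as List∈
open import Data.Nat.Base as ℕ using (ℕ; zero; suc; _+_; _*_; _^_; _∸_; _≤_; _<_; z≤n; s≤s; NonZero)
open import Data.Nat.DivMod using (_mod_; m%n<n; m<n⇒m%n≡m; n%n≡0; _%_)
open import Data.Nat.Properties as ℕ using (_≤?_; ≤-trans; n≤1+n; 1+n≢n; n<1+n; m<n⇒m<1+n; <⇒≢; <⇒≱; m≤n⇒m<n∨m≡n; m+n≡0⇒m≡0; m+1+n≢0)
open import Data.Product using (∃; ∃!; _×_; _,_; swap)
open import Data.Product.Properties using (,-injectiveˡ; ,-injectiveʳ) renaming (≡-dec to ×-≡-dec)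
open import Data.Rational.Base as ℚ using (ℚ; _/_)
open import Data.Sum.Base using (_⊎_; inj₁; inj₂)
open import Data.Vec.Base using (_∷_; [])
open import Function.Base using (_∘_; case_of_)
open import Relation.Binary.Construct.Closure.ReflexiveTransitive using (Star; ε; _◅_)
open import Relation.Binary.PropositionalEquality using (_≡_; _≢_; refl; sym; trans; cong; subst)
open import Relation.Nullary using (¬_; Dec; yes; no; contradiction)
open import Relation.Nullary.Decidable using (map′; _×-dec_; _⊎-dec_; _→-dec_; ¬?)
open import Relation.Unary using (Pred; Decidable)

-- The edge set is listed without repetition by Fin size; the order in
-- which ends lists the two ends of an edge is irrelevant.
record Graph : Set where
  field
    order size : ℕ
    ends       : Fin size → Fin order × Fin order

  Joins : Fin size → Fin order → Fin order → Set
  Joins e u v = ends e ≡ (u , v) ⊎ ends e ≡ (v , u)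

  field
    loopless : ∀ e u → ¬ Joins e u u
    simple   : ∀ e f u v → Joins e u v → Joins f u v → e ≡ f

-- A spanning subgraph contains all the vertices, so it is given by its
-- set of edges S.
module _ (G : Graph) where
  open Graph G

  Adjacent : Subset size → Fin order → Fin order → Set
  Adjacent S u v = ∃ λ e → e ∈ S × Joins e u v

  Connected : Subset size → Fin order → Fin order → Set
  Connected S = Star (Adjacent S)

  -- v ∷ vs lists the vertices of a cycle of length at least 3, in order.
  data IsCycle (S : Subset size) : List (Fin order) → Set where
    cycle : ∀ {v vs} → 2 ≤ length vs → Unique (v ∷ vs) →
            Linked (Adjacent S) (v ∷ vs ++ [ v ]) → IsCycle S (v ∷ vs)

  Acyclic : Subset size → Set
  Acyclic S = ¬ ∃ (IsCycle S)

  -- The second component says that, for every vertex v, the connected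
  -- component of v contains exactly one element of R.
  RootedSpanningForest : Subset order → Subset size → Set
  RootedSpanningForest R S =
    Acyclic S × (∀ v → ∃! _≡_ λ ρ → ρ ∈ R × Connected S v ρ)

-- The following results, up to rootedSpanningForest?, serve only to make
-- the count ℱ computable.

unique⇒length≤ : ∀ {n} {xs : List (Fin n)} → Unique xs → length xs ≤ n
unique⇒length≤ {xs = xs} u = Fin.injective⇒≤ {f = lookup xs} (inj u _ _)
  where
  inj : ∀ {n} {xs : List (Fin n)} → Unique xs →
        ∀ i j → lookup xs i ≡ lookup xs j → i ≡ j
  inj (x∉ ∷ u) zero    zero    eq = refl
  inj (x∉ ∷ u) zero    (suc j) eq = contradiction eq (All.lookup x∉ (∈-lookup j))
  inj (x∉ ∷ u) (suc i) zero    eq = contradiction (sym eq) (All.lookup x∉ (∈-lookup i))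
  inj (x∉ ∷ u) (suc i) (suc j) eq = cong suc (inj u i j eq)

anyShortList? : ∀ {n p} (k : ℕ) {P : Pred (List (Fin n)) p} → Decidable P →
                Dec (∃ λ xs → length xs ≤ k × P xs)
anyShortList? zero P? = map′ (λ p → [] , z≤n , p) (λ { ([] , _ , p) → p }) (P? [])
anyShortList? (suc k) {P} P? =
  map′ (λ { (inj₁ p) → [] , z≤n , p
          ; (inj₂ (x , xs , l , p)) → x ∷ xs , s≤s l , p })
       (λ { ([] , _ , p) → inj₁ p
          ; (x ∷ xs , s≤s l , p) → inj₂ (x , xs , l , p) })
       (P? [] ⊎-dec any? λ x → anyShortList? k {λ xs → P (x ∷ xs)} (λ xs → P? (x ∷ xs)))

module _ (G : Graph) where
  open Graph G

  joins? : ∀ e u v → Dec (Joins e u v)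
  joins? e u v = (ends e ≟ (u , v)) ⊎-dec (ends e ≟ (v , u))
    where _≟_ = ×-≡-dec Fin._≟_ Fin._≟_

  adjacent? : ∀ S u v → Dec (Adjacent G S u v)
  adjacent? S u v = any? λ e → (e ∈? S) ×-dec joins? e u v

  module _ (S : Subset size) where

    -- Path u vs v: the list u ∷ vs is a walk ending in v.
    Path : Fin order → List (Fin order) → Fin order → Set
    Path u []       v = u ≡ v
    Path u (w ∷ ws) v = Adjacent G S u w × Path w ws v

    path? : ∀ u vs v → Dec (Path u vs v)
    path? u []       v = u Fin.≟ v
    path? u (w ∷ ws) v = adjacent? S u w ×-dec path? w ws v

    path⇒connected : ∀ {u} vs {v} → Path u vs v → Connected G S u v
    path⇒connected []       refl    = ε
    path⇒connected (w ∷ ws) (a , p) = a ◅ path⇒connected ws p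

    truncate : ∀ {u w} ws {v} → u List∈.∈ (w ∷ ws) → Unique (w ∷ ws) → Path w ws v →
               ∃ λ us → Unique (u ∷ us) × Path u us v
    truncate ws       (here refl) q       p       = ws , q , p
    truncate (x ∷ ws) (there u∈)  (_ ∷ q) (_ , p) = truncate ws u∈ q p

    connected⇒path : ∀ {u v} → Connected G S u v →
                     ∃ λ vs → Unique (u ∷ vs) × Path u vs v
    connected⇒path ε = [] , ([] ∷ []) , refl
    connected⇒path {u} (_◅_ {j = w} a c) with connected⇒path c
    ... | ws , q , p with Any.any? (u Fin.≟_) (w ∷ ws)
    ...   | yes u∈ = truncate ws u∈ q p
    ...   | no  u∉ = w ∷ ws , (¬Any⇒All¬ _ u∉ ∷ q) , (a , p)

    connected? : ∀ u v → Dec (Connected G S u v)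
    connected? u v =
      map′ (λ { (vs , _ , p) → path⇒connected vs p })
           (λ c → case connected⇒path c of λ where
             (vs , q , p) → vs , ≤-trans (n≤1+n _) (unique⇒length≤ q) , p)
           (anyShortList? order (λ vs → path? u vs v))

    isCycle? : ∀ vs → Dec (IsCycle G S vs)
    isCycle? []       = no λ ()
    isCycle? (v ∷ vs) =
      map′ (λ { (l , q , p) → cycle l q p }) (λ { (cycle l q p) → l , q , p })
        ((2 ≤? length vs) ×-dec
         (allPairs? (λ x y → ¬? (x Fin.≟ y)) (v ∷ vs) ×-dec
          linked? (adjacent? S) (v ∷ vs ++ [ v ])))

    acyclic? : Dec (Acyclic G S)
    acyclic? = ¬? (map′ (λ { (vs , _ , c) → vs , c })
                        (λ { (vs , cycle l q p) → vs , unique⇒length≤ q , cycle l q p })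
                        (anyShortList? order isCycle?))

  rootedSpanningForest? : ∀ R → Decidable (RootedSpanningForest G R)
  rootedSpanningForest? R S = acyclic? S ×-dec all? λ v → any? λ ρ →
    root? v ρ ×-dec map′ (λ f {y} → f y) (λ f y → f {y}) (all? λ y → root? v y →-dec (ρ Fin.≟ y))
    where
    root? : ∀ v ρ → Dec (ρ ∈ R × Connected G S v ρ)
    root? v ρ = (ρ ∈? R) ×-dec connected? S v ρ

allSubsets : ∀ n → List (Subset n)
allSubsets zero    = [ [] ]
allSubsets (suc n) = map (outside ∷_) (allSubsets n) ++ map (inside ∷_) (allSubsets n)

ℱ : (G : Graph) → Subset (Graph.order G) → ℕ
ℱ G R = length (filter (rootedSpanningForest? G R) (allSubsets (Graph.size G)))

next : ∀ {N} → Fin N → Fin N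
next {suc n} i = suc (toℕ i) mod suc n

-- Vertex zero is the centre c and vertex suc i is the rim vertex whose
-- 1-based label is suc (toℕ i).
wheelEnds : ∀ N → Fin (N + N) → Fin (suc N) × Fin (suc N)
wheelEnds N e with splitAt N e
... | inj₁ i = suc i , suc (next i)
... | inj₂ i = zero , suc i

toℕ-next : ∀ {N} (i : Fin N) → (suc (toℕ i) < N × toℕ (next i) ≡ suc (toℕ i)) ⊎
                               (suc (toℕ i) ≡ N × toℕ (next i) ≡ 0)
toℕ-next {suc n} i with m≤n⇒m<n∨m≡n (toℕ<n i)
... | inj₁ lt = inj₁ (lt , trans (toℕ-fromℕ< (m%n<n (suc (toℕ i)) (suc n))) (m<n⇒m%n≡m lt))
... | inj₂ eq = inj₂ (eq , trans (toℕ-fromℕ< (m%n<n (suc (toℕ i)) (suc n)))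
                                 (trans (cong (_% suc n) eq) (n%n≡0 (suc n))))

next-≢ : ∀ {N} → 3 ≤ N → (i : Fin N) → next i ≢ i
next-≢ N≥3 i eq with toℕ-next i | cong toℕ eq
... | inj₁ (_ , p) | q = 1+n≢n (trans (sym p) q)
... | inj₂ (s , p) | q with trans (sym q) p
...   | i≡0 rewrite i≡0 = case subst (3 ≤_) (sym s) N≥3 of λ { (s≤s ()) }

next²-≢ : ∀ {N} → 3 ≤ N → (i : Fin N) → next (next i) ≢ i
next²-≢ N≥3 i eq with toℕ-next i | toℕ-next (next i) | cong toℕ eq
... | inj₁ (_ , p) | inj₁ (_ , p′) | q =
  <⇒≢ (m<n⇒m<1+n (n<1+n _)) (trans (sym q) (trans p′ (cong suc p)))
... | inj₁ (_ , p) | inj₂ (s , p′) | q with trans (sym q) p′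
...   | i≡0 rewrite p | i≡0 = case subst (3 ≤_) (sym s) N≥3 of λ { (s≤s (s≤s ())) }
next²-≢ N≥3 i eq | inj₂ (s , p) | inj₁ (_ , p′) | q
  rewrite p | trans (sym q) p′ = case subst (3 ≤_) (sym s) N≥3 of λ { (s≤s (s≤s ())) }
next²-≢ N≥3 i eq | inj₂ (s , p) | inj₂ (s′ , p′) | q
  rewrite p = case subst (3 ≤_) (sym s′) N≥3 of λ { (s≤s ()) }

module _ (N : ℕ) (N≥3 : 3 ≤ N) where

  private
    J : Fin (N + N) → Fin (suc N) → Fin (suc N) → Set
    J e u v = wheelEnds N e ≡ (u , v) ⊎ wheelEnds N e ≡ (v , u)

    sucInj : ∀ {i j : Fin N} → Fin.suc i ≡ suc j → i ≡ j
    sucInj refl = refl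

  wheel-loopless : ∀ e u → ¬ J e u u
  wheel-loopless e u j with splitAt N e | (case j of λ { (inj₁ p) → p ; (inj₂ p) → p })
  ... | inj₁ i | p = next-≢ N≥3 i (sucInj (trans (,-injectiveʳ p) (sym (,-injectiveˡ p))))
  ... | inj₂ i | p with trans (,-injectiveʳ p) (sym (,-injectiveˡ p))
  ...   | ()

  same-or-swapped : ∀ e f u v → J e u v → J f u v →
                    wheelEnds N e ≡ wheelEnds N f ⊎
                    wheelEnds N e ≡ swap (wheelEnds N f)
  same-or-swapped e f u v (inj₁ p) (inj₁ q) = inj₁ (trans p (sym q))
  same-or-swapped e f u v (inj₁ p) (inj₂ q) = inj₂ (trans p (sym (cong swap q)))
  same-or-swapped e f u v (inj₂ p) (inj₁ q) = inj₂ (trans p (sym (cong swap q)))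
  same-or-swapped e f u v (inj₂ p) (inj₂ q) = inj₁ (trans p (sym q))

  wheel-simple : ∀ e f u v → J e u v → J f u v → e ≡ f
  wheel-simple e f u v je jf with same-or-swapped e f u v je jf
  ... | c with splitAt N e in eqe | splitAt N f in eqf
  wheel-simple e f u v je jf | inj₁ p | inj₁ i | inj₁ j with sucInj (,-injectiveˡ p)
  ... | refl = trans (sym (splitAt⁻¹-↑ˡ eqe)) (splitAt⁻¹-↑ˡ eqf)
  wheel-simple e f u v je jf | inj₁ () | inj₁ i | inj₂ j
  wheel-simple e f u v je jf | inj₁ () | inj₂ i | inj₁ j
  wheel-simple e f u v je jf | inj₁ p | inj₂ i | inj₂ j with sucInj (,-injectiveʳ p)
  ... | refl = trans (sym (splitAt⁻¹-↑ʳ eqe)) (splitAt⁻¹-↑ʳ eqf)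
  wheel-simple e f u v je jf | inj₂ p | inj₁ i | inj₁ j
    with sucInj (,-injectiveˡ p) | sucInj (,-injectiveʳ p)
  ... | refl | q = ⊥-elim (next²-≢ N≥3 j q)
  wheel-simple e f u v je jf | inj₂ p | inj₁ i | inj₂ j with ,-injectiveʳ p
  ... | ()
  wheel-simple e f u v je jf | inj₂ p | inj₂ i | inj₁ j with ,-injectiveˡ p
  ... | ()
  wheel-simple e f u v je jf | inj₂ p | inj₂ i | inj₂ j with ,-injectiveˡ p
  ... | ()

  wheel : Graph
  wheel = record
    { order    = suc N
    ; size     = N + N
    ; ends     = wheelEnds N
    ; loopless = wheel-loopless
    ; simple   = wheel-simple
    }

  ℱ-wheel : Subset N → ℕ
  ℱ-wheel R = ℱ wheel (outside ∷ R)

labels : ∀ {N} → Subset N → List ℕ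
labels {N} R = map (suc ∘ toℕ) (filter (_∈? R) (allFin N))

-- For increasing labels no subtraction is truncated:
-- gaps e (a₁ ∷ ⋯ ∷ aᵣ) = (a₂ ∸ a₁) ∷ ⋯ ∷ (aᵣ ∸ aᵣ₋₁) ∷ (e ∸ aᵣ)
gaps : ℕ → List ℕ → List ℕ
gaps e []            = []
gaps e (a ∷ [])      = [ e ∸ a ]
gaps e (a ∷ b ∷ as)  = b ∸ a ∷ gaps e (b ∷ as)

closeUp : ℕ → List ℕ → List ℕ
closeUp N []       = []
closeUp N (a ∷ as) = gaps (a + N) (a ∷ as)

cyclicIntervals : ∀ {N} → Subset N → List ℕ
cyclicIntervals {N} R = closeUp N (labels R)

occurrences : ℕ → List ℕ → ℕ
occurrences x xs = length (filter (ℕ._≟ x) xs)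

OneIs-RestAre : ℕ → ℕ → List ℕ → Set
OneIs-RestAre x y xs =
  ∃ λ i → lookup xs i ≡ x × (∀ j → j ≢ i → lookup xs j ≡ y)

module _ {A : Set} (P : A → Set) (f : A → ℕ) where

  Maximizes : A → Set
  Maximizes x = ∀ y → P y → f y ≤ f x

  Minimizes : A → Set
  Minimizes x = ∀ y → P y → f x ≤ f y

  IsMaximum : ℚ → Set
  IsMaximum m = ∃ λ x → P x × Maximizes x × + f x / 1 ≡ m

  IsMinimum : ℚ → Set
  IsMinimum m = ∃ λ x → P x × Minimizes x × + f x / 1 ≡ m

F : ℕ → ℕ
F zero          = 0
F (suc zero)    = 1
F (suc (suc n)) = F (suc n) + F n

L : ℕ → ℕ
L zero          = 2
L (suc zero)    = 1
L (suc (suc n)) = L (suc n) + L n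

F-nonZero : ∀ n → NonZero (F (suc n))
F-nonZero zero    = _
F-nonZero (suc n) = ℕ.≢-nonZero λ eq →
  ℕ.≢-nonZero⁻¹ (F (suc n)) {{F-nonZero n}} (m+n≡0⇒m≡0 (F (suc n)) eq)

F2-nonZero : ∀ k .{{_ : NonZero k}} → NonZero (F (2 * k))
F2-nonZero (suc k) = F-nonZero (k + suc (k + 0))

quotient-nonZero : ∀ {N r q s} → r ≤ N → N ≡ q * r + s → s < r → NonZero q
quotient-nonZero {q = zero}  r≤N refl s<r = contradiction r≤N (<⇒≱ s<r)
quotient-nonZero {q = suc _} _   _    _   = _

-- The truncated subtractions below are exact whenever s ≤ r and 1 ≤ r ≤ N.

ratio : (k : ℕ) .{{_ : NonZero k}} → ℚ
ratio k = (L (2 * k) ⊖ 2) / F (2 * k)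
  where instance _ = F2-nonZero k

maxValue : (r q s : ℕ) .{{_ : NonZero q}} → ℚ
maxValue r q s =
  + (F (2 * (q + 1)) ^ s * F (2 * q) ^ (r ∸ s)) / 1 ℚ.*
  (+ s / 1 ℚ.* ratio (q + 1) ℚ.+ + (r ∸ s) / 1 ℚ.* ratio q)
  where instance _ = ℕ.≢-nonZero {q + 1} (m+1+n≢0 q)

minValue : (N r : ℕ) → ℚ
minValue N r =
  ((L (2 * (N ∸ r + 1)) ⊖ 2) ℤ.+ + ((r ∸ 1) * F (2 * (N ∸ r + 1)))) / 1

{-# OPTIONS --safe #-}
module Submission where

-- Cut the rim at its absent edges: the rooted spanning forests are the edge
-- sets in which every arc of the rim has either one root and no spoke or one
-- spoke and no root, except for exactly one arc with a root and a spoke. They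
-- are counted by a transfer matrix along the rim. Its trace is invariant under
-- rotation, and with the cyclic intervals dᵢ = kᵢ + 1 it evaluates to
-- Z(k₁ , … , kᵣ) = Σᵢ (L₂dᵢ − 2) ∏ⱼ≠ᵢ F₂dⱼ. By d'Ocagne's identity and the
-- convexity of F₂d, bringing two intervals that differ by at least 2 closer
-- together while keeping their sum strictly increases Z, so the maximum is
-- attained exactly at the most even intervals and the minimum at the most
-- uneven ones.

-- Two features of this description are global. That only one arc has both a root and a spoke is
-- charged to the vertex at which the arc first contains both, so a one-bit counter suffices; the
-- transfer matrices become block triangular with equal diagonal blocks, D + εC with ε² = 0, and the
-- count is the ε-coefficient of the trace. That a run along the rim closes up is no further choice:
-- an acyclic edge set leaves out a rim edge, where all content is forgotten, so exactly one initial
-- content returns to itself and the trace counts each forest once. The even-indexed Fibonacci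
-- numbers come from the matrix with rows (2, 1) and (1, 1) of a vertex that is no root, the square
-- of the Fibonacci matrix; L₂d - 2 arises without subtraction as a sum of two partial sums of the
-- F₂ᵢ. Strictness of smoothing gives one direction of both equivalences, since an extremal sequence
-- admits no improvement. For the other, all sequences of the stated shape are permutations of one
-- another and share their `Z`. Repeated smoothing stops because the count is bounded by the number
-- of edge sets.

open import Defs
open import Data.Bool.Base using (Bool; true; false; _∧_; _∨_; not)
open import Data.Bool.Properties using (∨-zeroʳ; ∧-zeroʳ; ∨-identityʳ) renaming (_≟_ to _≟ᵇ_)
open import Data.Empty using (⊥; ⊥-elim)
open import Data.Unit.Base using (⊤; tt)
open import Data.Fin.Base as Fin using (Fin; zero; suc; toℕ; splitAt; _↑ˡ_; _↑ʳ_)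
open import Data.Fin.Properties as Fin using (toℕ<n; toℕ-injective; splitAt-↑ˡ; splitAt-↑ʳ; splitAt⁻¹-↑ˡ; splitAt⁻¹-↑ʳ; ↑ˡ-injective; ↑ʳ-injective)
open import Data.Fin.Subset using (Subset; ∣_∣; _∈_; _∉_; _-_; ⁅_⁆; inside; outside)
open import Data.Fin.Subset.Properties using (p─q⊆p; x∈p∧x≢y⇒x∈p-y; _∈?_)
open import Data.Integer.Base as ℤ using (_⊖_)
import Data.Integer.Properties as ℤ
open import Data.List.Base using (List; []; _∷_; _++_; [_]; length; map; filter; tabulate; lookup; replicate)
open import Data.List.Properties using (filter-++; filter-accept; filter-reject; length-++; length-replicate; ++-assoc; ++-identityʳ; length-map; map-∘; map-id; map-replicate; length-filter)
open import Data.List.Relation.Unary.All as All using (All; []; _∷_)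
open import Data.List.Membership.Propositional.Properties using (∈-lookup)
import Data.List.Relation.Unary.All.Properties as All
open import Data.List.Relation.Unary.AllPairs using ([]; _∷_)
open import Data.List.Relation.Unary.Linked using (Linked; []; [-]; _∷_)
open import Data.List.Relation.Unary.Unique.Propositional using (Unique)
open import Data.List.Relation.Binary.Permutation.Propositional as Perm using (_↭_; ↭-refl; ↭-sym; ↭-trans; ↭-prep; ↭-swap)
open import Data.List.Relation.Binary.Permutation.Propositional.Properties using (↭-length; All-resp-↭; map⁺; filter-↭; shift)
open import Data.Nat.Base as ℕ using (ℕ; zero; suc; _+_; _*_; _^_; _∸_; _≤_; _<_; z≤n; s≤s; NonZero; pred)
open import Data.Nat.ListAction using (sum)
open import Data.Nat.ListAction.Properties using (sum-↭)
open import Data.Nat.Properties as ℕ using (≤-refl; ≤-trans; <-trans; <-irrefl; n<1+n; suc-injective; +-comm; +-assoc; +-suc; *-comm; *-assoc; +-identityʳ)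
open import Data.Nat.Tactic.RingSolver using (solve-∀)
open import Data.Product using (∃; ∃!; _×_; _,_; proj₁; proj₂; uncurry)
open import Data.Rational.Base as ℚ using (_/_)
import Data.Rational.Properties as ℚ
import Data.Rational.Unnormalised.Base as ℚᵘ
import Data.Rational.Unnormalised.Properties as ℚᵘ
open import Data.Sum.Base using (_⊎_; inj₁; inj₂; swap)
open import Data.Vec.Base as Vec using (Vec; []; _∷_; there)
open import Data.Vec.Properties using ([]=⇒lookup; lookup⇒[]=; lookup-++ˡ; lookup-++ʳ; length-toList; toList∘fromList)
open import Function.Base using (_∘_; id)
open import Function.Bundles using (_⇔_; mk⇔)
open import Relation.Binary.Construct.Closure.ReflexiveTransitive using (ε; _◅_; _◅◅_; reverse)
open import Relation.Binary.PropositionalEquality using (_≡_; _≢_; refl; sym; trans; cong; cong₂; subst; module ≡-Reasoning)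
open import Relation.Binary.Definitions using (tri<; tri≈; tri>)
open import Relation.Nullary using (¬_; Dec; yes; no; contradiction)

-- Forests and cycles

module _ (G : Graph) where
  open Graph G

  private
    V = Fin order

    data NonBacktracking : List V → Set where
      [-] : ∀ {u} → NonBacktracking (u ∷ [])
      [-,-] : ∀ {u v} → NonBacktracking (u ∷ v ∷ [])
      _∷_ : ∀ {u v w vs} → u ≢ w → NonBacktracking (v ∷ w ∷ vs) →
            NonBacktracking (u ∷ v ∷ w ∷ vs)

    closed-nonBacktracking : ∀ {u v vs} → Unique (v ∷ vs) → All (u ≢_) (v ∷ vs) →
                             NonBacktracking (v ∷ vs ++ [ u ])
    closed-nonBacktracking {vs = []} _ _ = [-,-]
    closed-nonBacktracking {vs = w ∷ []} (_ ∷ q) (u≢v ∷ u∉) =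
      (u≢v ∘ sym) ∷ closed-nonBacktracking q u∉
    closed-nonBacktracking {vs = w ∷ x ∷ vs} ((_ ∷ v≢x ∷ _) ∷ q) (_ ∷ u∉) =
      v≢x ∷ closed-nonBacktracking q u∉

    -- The last vertex of u ∷ v ∷ vs and its predecessor.
    lastTwo : V → V → List V → V × V
    lastTwo u v []       = v , u
    lastTwo u v (w ∷ vs) = lastTwo v w vs

    -- The clause about `P` expresses that `y` is one of `v ∷ vs`, in the form in which it is used.
    lastTwo-∷ʳ : ∀ u v vs x → ∃ λ y → lastTwo u v (vs ++ [ x ]) ≡ (x , y) ×
                 (∀ {P : V → Set} → P v → All P vs → P y)
    lastTwo-∷ʳ u v []       x = v , refl , λ p _ → p
    lastTwo-∷ʳ u v (w ∷ vs) x with lastTwo-∷ʳ v w vs x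
    ... | y , eq , f = y , eq , λ { _ (p ∷ ps) → f p ps }

  -- A walk that never backtracks first descends along par and then
  -- ascends; a closed one would return to its start through par.
  acyclic-by-rank : ∀ {S} (par : V → V) (rank : V → ℕ) →
    (∀ {u v} → Adjacent G S u v → (v ≡ par u × rank v < rank u) ⊎
                                  (u ≡ par v × rank u < rank v)) →
    Acyclic G S
  acyclic-by-rank {S} par rank orient (._ , cycle {v} {w ∷ x ∷ xs} _ (v∉@(_ ∷ v≢x ∷ _) ∷ q@((w≢x ∷ w∉) ∷ _)) l)
    = no-turn (x ∷ xs ++ [ v ]) (lastTwo-∷ʳ w x xs v) (v≢x ∷ closed-nonBacktracking q v∉) l
    where
    -- A downward step from `w` would lead to `par w`, that is, straight back to `u`; so an ascent
    -- never ends.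
    ascend : ∀ u w vs → NonBacktracking (u ∷ w ∷ vs) → Linked (Adjacent G S) (u ∷ w ∷ vs) →
             u ≡ par w → rank u < rank w →
             let z , y = lastTwo u w vs in y ≡ par z × rank u < rank z
    ascend u w []       _          _             up lt = up , lt
    ascend u w (x ∷ vs) (u≢x ∷ nb) (_ ∷ l@(a ∷ _)) up lt with orient a
    ... | inj₁ (x≡ , _)  = contradiction (trans up (sym x≡)) u≢x
    ... | inj₂ (up′ , lt′) with ascend w x vs nb l up′ lt′
    ...   | r , lt″ = r , <-trans lt lt″

    lower-or-ascending : ∀ u w vs → NonBacktracking (u ∷ w ∷ vs) →
                         Linked (Adjacent G S) (u ∷ w ∷ vs) →
                         let z , y = lastTwo u w vs in rank z < rank u ⊎ y ≡ par z
    lower-or-ascending u w vs nb l@(a ∷ _) with orient a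
    lower-or-ascending u w vs nb l | inj₂ (up , lt) = inj₂ (proj₁ (ascend u w vs nb l up lt))
    lower-or-ascending u w [] nb l | inj₁ (_ , lt) = inj₁ lt
    lower-or-ascending u w (x ∷ vs) (_ ∷ nb) (_ ∷ l) | inj₁ (_ , lt)
      with lower-or-ascending w x vs nb l
    ... | inj₁ lt′ = inj₁ (<-trans lt′ lt)
    ... | inj₂ up  = inj₂ up

    no-turn : ∀ vs → (∃ λ y → lastTwo v w vs ≡ (v , y) × (∀ {P : V → Set} → P x → All P xs → P y)) →
              NonBacktracking (v ∷ w ∷ vs) → Linked (Adjacent G S) (v ∷ w ∷ vs) → ⊥
    no-turn vs (y , eq , f) nb l@(a ∷ _)
      with lower-or-ascending v w vs nb l | ascend v w vs nb l | orient a
    ... | _ | up | inj₂ (v≡ , lt) =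
      <-irrefl (cong (rank ∘ proj₁) (sym eq)) (proj₂ (up v≡ lt))
    ... | inj₁ lt | _ | _ = <-irrefl (cong (rank ∘ proj₁) eq) lt
    -- Both `w` and `y` equal `par v`, but `y` is among `x ∷ xs`, all distinct from `w`.
    ... | inj₂ y≡ | _ | inj₁ (w≡ , _) =
      f {w ≢_} w≢x w∉ (trans w≡ (sym (trans (cong proj₂ (sym eq)) (trans y≡ (cong (par ∘ proj₁) eq)))))
  acyclic-by-rank par rank orient (._ , cycle {vs = _ ∷ []} (s≤s ()) _ _)

  -- A simple path avoiding `e` has no edge, one edge, or at least two. These cases contradict in
  -- turn looplessness, simplicity of the graph, and acyclicity, since with `e` the last one closes
  -- a cycle of length at least 3.
  edge-not-in-cycle : ∀ {S} → Acyclic G S → ∀ {e u v} → e ∈ S → Joins e u v →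
                      ¬ Connected G (S - e) u v
  edge-not-in-cycle {S} acyclic {e} {u} {v} e∈S joins conn with connected⇒path G (S - e) conn
  ... | [] , _ , refl = loopless e u joins
  ... | w ∷ [] , _ , (f , f∈ , joins′) , refl =
    x∉p-x e (subst (_∈ S - e) (simple f e u w joins′ joins) f∈)
    where
    x∉p-x : ∀ {n} {p : Subset n} (x : Fin n) → x ∉ p - x
    x∉p-x {p = inside ∷ p}  (suc x) (there h) = x∉p-x x h
    x∉p-x {p = outside ∷ p} (suc x) (there h) = x∉p-x x h
    x∉p-x {p = inside ∷ p}  zero ()
    x∉p-x {p = outside ∷ p} zero ()
  ... | w ∷ x ∷ ws , q , p = acyclic (_ , cycle (s≤s (s≤s z≤n)) q (closing (w ∷ x ∷ ws) p))
    where
    include : ∀ {x y} → Adjacent G (S - e) x y → Adjacent G S x y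
    include (f , f∈ , j) = f , p─q⊆p S ⁅ e ⁆ f∈ , j

    closing : ∀ {x} ws → Path G (S - e) x ws v → Linked (Adjacent G S) (x ∷ ws ++ [ u ])
    closing []       refl    = (e , e∈S , swap joins) ∷ [-]
    closing (w ∷ ws) (a , p) = include a ∷ closing ws p

  connected-sym : ∀ {S u v} → Connected G S u v → Connected G S v u
  connected-sym = reverse λ (e , e∈ , j) → e , e∈ , swap j

-- Arcs of the rim

next-injective : ∀ {N} {i j : Fin N} → next i ≡ next j → i ≡ j
next-injective {i = i} {j} eq with toℕ-next i | toℕ-next j | cong toℕ eq
... | inj₁ (_ , p) | inj₁ (_ , q) | r = toℕ-injective (suc-injective (trans (sym p) (trans r q)))
... | inj₁ (_ , p) | inj₂ (_ , q) | r = contradiction (trans (sym p) (trans r q)) λ ()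
... | inj₂ (_ , p) | inj₁ (_ , q) | r = contradiction (trans (sym p) (trans r q)) λ ()
... | inj₂ (p , _) | inj₂ (q , _) | _ = toℕ-injective (suc-injective (trans p (sym q)))

next-surjective : ∀ {N} (i : Fin N) → ∃ λ j → next j ≡ i
next-surjective {suc n} i with toℕ i in eq
... | zero  = Fin.fromℕ n , toℕ-injective (trans last (sym eq))
  where
  last : toℕ (next (Fin.fromℕ n)) ≡ 0
  last with toℕ-next (Fin.fromℕ n)
  ... | inj₁ (lt , _) = contradiction (subst (_< suc n) (cong suc (Fin.toℕ-fromℕ n)) lt) (<-irrefl refl)
  ... | inj₂ (_ , p) = p
... | suc m = j , toℕ-injective (trans step (sym eq))
  where
  m<n : suc m < suc n
  m<n = subst (_< suc n) eq (toℕ<n i)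
  j : Fin (suc n)
  j = Fin.fromℕ< (<-trans (n<1+n m) m<n)
  j≡m : toℕ j ≡ m
  j≡m = Fin.toℕ-fromℕ< (<-trans (n<1+n m) m<n)
  step : toℕ (next j) ≡ suc m
  step with toℕ-next j
  ... | inj₁ (_ , p) = trans p (cong suc j≡m)
  ... | inj₂ (p , _) = contradiction (trans (sym p) (cong suc j≡m)) (ℕ.<⇒≢ m<n ∘ sym)

module Rim {N : ℕ} (e : Fin N → Bool) where

  infix 4 _↝_
  data _↝_ (i : Fin N) : Fin N → Set where
    stay : i ↝ i
    step : ∀ {j} → i ↝ j → e j ≡ true → i ↝ next j

  ↝-trans : ∀ {i j k} → i ↝ j → j ↝ k → i ↝ k
  ↝-trans a stay       = a
  ↝-trans a (step b q) = step (↝-trans a b) q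

  step-first : ∀ {i j} → e i ≡ true → next i ↝ j → i ↝ j
  step-first q = ↝-trans (step stay q)

  first-step : ∀ {i j} → i ↝ j → i ≡ j ⊎ (e i ≡ true × next i ↝ j)
  first-step stay = inj₁ refl
  first-step (step a q) with first-step a
  ... | inj₁ refl     = inj₂ (q , stay)
  ... | inj₂ (q′ , b) = inj₂ (q′ , step b q)

  -- Every step of a walk is forced, so two walks with the same start are comparable; and no walk
  -- leaves a vertex whose edge is absent.
  end-unique : ∀ {i j k} → i ↝ j → e j ≡ false → i ↝ k → e k ≡ false → j ≡ k
  end-unique a p b q with ↝-compare a b
    where
    ↝-compare : ∀ {i j k} → i ↝ j → i ↝ k → j ↝ k ⊎ k ↝ j
    ↝-compare stay b = inj₁ b
    ↝-compare (step a q) b with ↝-compare a b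
    ... | inj₂ c = inj₂ (step c q)
    ... | inj₁ c with first-step c
    ...   | inj₁ refl    = inj₂ (step stay q)
    ...   | inj₂ (_ , d) = inj₁ d
  ... | inj₁ c with first-step c
  ...   | inj₁ eq = eq
  ...   | inj₂ (t , _) = contradiction (trans (sym t) p) λ ()
  end-unique a p b q | inj₂ c with first-step c
  ...   | inj₁ eq = sym eq
  ...   | inj₂ (t , _) = contradiction (trans (sym t) q) λ ()

  -- Unrolls the rim from the absent edge at k on.
  module Cut (k : Fin N) (cut : e k ≡ false) where

    position : Fin N → ℕ
    position i with toℕ i ℕ.≤? toℕ k
    ... | yes _ = toℕ i + N
    ... | no  _ = toℕ i

    position< : ∀ i → position i < N + N
    position< i with toℕ i ℕ.≤? toℕ k
    ... | yes _ = ℕ.+-monoˡ-< N (toℕ<n i)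
    ... | no  _ = ℕ.<-≤-trans (toℕ<n i) (ℕ.m≤m+n N N)

    position-next : ∀ {i} → e i ≡ true → position (next i) ≡ suc (position i)
    position-next {i} q with toℕ i ℕ.≤? toℕ k | toℕ (next i) ℕ.≤? toℕ k | toℕ-next i
    ... | yes _ | yes _ | inj₁ (_ , p) = cong (_+ N) p
    ... | yes a | no b  | inj₁ (_ , p) =
      contradiction (toℕ-injective (ℕ.≤-antisym a (ℕ.≮⇒≥ (b ∘ subst (_≤ toℕ k) (sym p)))))
        λ { refl → contradiction (trans (sym q) cut) λ () }
    ... | no a  | yes b | inj₁ (_ , p) = contradiction (ℕ.<⇒≤ (subst (_≤ toℕ k) p b)) a
    ... | no _  | no _  | inj₁ (_ , p) = p
    ... | yes a | _     | inj₂ (s , _) =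
      contradiction (toℕ-injective (ℕ.≤-antisym a (ℕ.s≤s⁻¹ (subst (toℕ k <_) (sym s) (toℕ<n k)))))
        λ { refl → contradiction (trans (sym q) cut) λ () }
    ... | no _  | yes _ | inj₂ (s , p) = trans (cong (_+ N) p) (sym s)
    ... | no _  | no b  | inj₂ (_ , p) = contradiction (subst (_≤ toℕ k) (sym p) z≤n) b

    ↝-position : ∀ {i j} → i ↝ j → position i ≤ position j
    ↝-position stay       = ≤-refl
    ↝-position (step a q) =
      ≤-trans (↝-position a) (ℕ.<⇒≤ (ℕ.≤-reflexive (sym (position-next q))))

    ↝-position-step : ∀ {i j} → i ↝ j → e j ≡ true → position i < position (next j)
    ↝-position-step a q = ℕ.<-≤-trans (s≤s (↝-position a)) (ℕ.≤-reflexive (sym (position-next q)))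

    ↝-antisym : ∀ {i j} → i ↝ j → j ↝ i → i ≡ j
    ↝-antisym stay       _ = refl
    ↝-antisym (step a q) b =
      contradiction (↝-position b) (ℕ.<⇒≱ (↝-position-step a q))

    end : ∀ i → ∃ λ j → i ↝ j × e j ≡ false
    end i = go (N + N) i (ℕ.m≤m+n _ _)
      where
      -- Each step raises the position by one, and positions stay below `N + N`.
      go : ∀ fuel i → N + N ≤ fuel + position i → ∃ λ j → i ↝ j × e j ≡ false
      go zero       i le = contradiction le (ℕ.<⇒≱ (position< i))
      go (suc fuel) i le with e i in eq
      ... | false = i , stay , eq
      ... | true  with go fuel (next i)
        (subst (N + N ≤_) (trans (sym (+-suc fuel _)) (cong (fuel +_) (sym (position-next eq)))) le)
      ...   | j , a , p = j , step-first eq a , p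

  -- γ i tells whether b holds for some rim vertex strictly before i in
  -- the arc of i.
  module Bit (b γ : Fin N → Bool) (rule : ∀ i → γ (next i) ≡ e i ∧ (γ i ∨ b i)) where

    γ⁺ : Fin N → Bool
    γ⁺ i = γ i ∨ b i

    γ⁺-next : ∀ {i} → e i ≡ true → γ⁺ i ≡ true → γ (next i) ≡ true
    γ⁺-next {i} q h = trans (rule i) (trans (cong (_∧ γ⁺ i) q) h)

    from-γ : ∀ {i} → γ i ≡ true → γ⁺ i ≡ true
    from-γ {i} h = cong (_∨ b i) h

    from-b : ∀ {i} → b i ≡ true → γ⁺ i ≡ true
    from-b {i} h = trans (cong (γ i ∨_) h) (∨-zeroʳ (γ i))

    persist : ∀ {i j} → b i ≡ true → i ↝ j → γ⁺ j ≡ true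
    persist h stay       = from-b h
    persist h (step a q) = from-γ (γ⁺-next q (persist h a))

    came-from : ∀ {j} → γ (next j) ≡ true → e j ≡ true × γ⁺ j ≡ true
    came-from {j} h with e j | trans (sym (rule j)) h
    ... | true | h′ = refl , h′

    module Exclusive (exclusive : ∀ i → γ i ∧ b i ≡ false) where

      not-both : ∀ {i} → γ i ≡ true → b i ≡ true → ⊥
      not-both {i} g h = contradiction (trans (sym (exclusive i)) (cong₂ _∧_ g h)) λ ()

      -- Both walks are traced back in parallel. If one is used up before the other, the vertex
      -- reached satisfies `b` and has another such vertex strictly before it in its arc, which
      -- `exclusive` forbids.
      source-unique : ∀ {i j k} → b i ≡ true → b j ≡ true → i ↝ k → j ↝ k → i ≡ j
      source-unique p q a b = go a b refl
        where
        go : ∀ {k l} → _ ↝ k → _ ↝ l → k ≡ l → _ ≡ _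
        go stay       stay       eq   = eq
        go stay       (step d t) refl = ⊥-elim (not-both (γ⁺-next t (persist q d)) p)
        go (step c t) stay       refl = ⊥-elim (not-both (γ⁺-next t (persist p c)) q)
        go (step c t) (step d u) eq   = go c d (next-injective eq)

    module Source (k : Fin N) (cut : e k ≡ false) where
      open Cut k cut

      source : ∀ {i} → γ⁺ i ≡ true → ∃ λ j → b j ≡ true × j ↝ i
      source {i} = go (suc (position i)) i ≤-refl
        where
        go : ∀ fuel i → position i < fuel → γ⁺ i ≡ true → ∃ λ j → b j ≡ true × j ↝ i
        go (suc fuel) i lt h with b i in eq
        ... | true  = i , eq , stay
        ... | false with next-surjective i
        ...   | i′ , refl with came-from (trans (sym (∨-identityʳ _)) h)
        ...     | q , h′ with go fuel i′ (ℕ.s≤s⁻¹ (subst (_< suc fuel) (position-next q) lt)) h′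
        ...       | j , p , a = j , p , step a q

      source-before : ∀ {i} → γ i ≡ true → ∃ λ j → b j ≡ true × j ↝ i × j ≢ i
      source-before {i} h with next-surjective i
      ... | i′ , refl with came-from h
      ...   | q , h′ with source h′
      ...     | j , p , a = j , p , step a q ,
        λ j≡i → <-irrefl (cong position j≡i) (↝-position-step a q)

linear-induction : ∀ {n} (P : Fin (suc n) → Set) → P zero →
                   (∀ j → suc (toℕ j) < suc n → P j → P (next j)) → ∀ j → P j
linear-induction P base ind j = go (toℕ j) j refl
  where
  go : ∀ m j → toℕ j ≡ m → P j
  go zero    j eq = subst P (sym (toℕ-injective eq)) base
  go (suc m) j eq with next-surjective j
  ... | j′ , refl with toℕ-next j′
  ...   | inj₁ (lt , p) = ind j′ lt (go m j′ (suc-injective (trans (sym p) eq)))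
  ...   | inj₂ (_ , p)  = contradiction (trans (sym p) eq) λ ()

-- The witness is first pushed past the end of the index range to `zero`; from there linear
-- induction reaches every index.
cyclic-induction : ∀ {N} (P : Fin N → Set) → (∀ j → P j → P (next j)) → ∃ P → ∀ j → P j
cyclic-induction {suc n} P ind (i , h) = linear-induction P (wrap (suc n) i (ℕ.m≤m+n _ _) h) (λ j _ → ind j)
  where
  wrap : ∀ fuel j → suc n ≤ fuel + toℕ j → P j → P zero
  wrap zero       j le h = contradiction (toℕ<n j) (ℕ.≤⇒≯ le)
  wrap (suc fuel) j le h with toℕ-next j
  ... | inj₁ (_ , p) = wrap fuel (next j)
    (subst (suc n ≤_) (trans (sym (+-suc fuel _)) (cong (fuel +_) (sym p))) le) (ind j h)
  ... | inj₂ (_ , p) = subst P (toℕ-injective p) (ind j h)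

∧-true : ∀ {x y} → x ∧ y ≡ true → x ≡ true × y ≡ true
∧-true {true} {true} _ = refl , refl

-- ρ i and σ i record whether the arc of rim edges ending in i has a root,
-- respectively a spoke, strictly before i; r i, p i and e i say whether i
-- is a root, its spoke is present, and its edge to next i is present.
doubles : (ρ σ r p : Bool) → Bool
doubles ρ σ r p = ((ρ ∨ r) ∧ (σ ∨ p)) ∧ not (ρ ∧ σ)

-- An arc without a root has exactly one spoke; an arc with a root has none,
-- except for the one arc through which the centre reaches its root.
record Certificate {N : ℕ} (r p e ρ σ : Fin N → Bool) : Set where
  field
    ρ-rule    : ∀ i → ρ (next i) ≡ e i ∧ (ρ i ∨ r i)
    σ-rule    : ∀ i → σ (next i) ≡ e i ∧ (σ i ∨ p i)
    one-root  : ∀ i → ρ i ∧ r i ≡ false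
    one-spoke : ∀ i → σ i ∧ p i ≡ false
    anchored  : ∀ i → e i ≡ false → (ρ i ∨ r i) ∨ (σ i ∨ p i) ≡ true
    one-double : ∃! _≡_ λ t → doubles (ρ t) (σ t) (r t) (p t) ≡ true

module Doubling {N : ℕ} (r p e ρ σ : Fin N → Bool)
  (ρ-rule : ∀ i → ρ (next i) ≡ e i ∧ (ρ i ∨ r i))
  (σ-rule : ∀ i → σ (next i) ≡ e i ∧ (σ i ∨ p i)) where

  open Rim e public
  module Root = Bit r ρ ρ-rule
  module Spoke = Bit p σ σ-rule

  double : Fin N → Bool
  double i = doubles (ρ i) (σ i) (r i) (p i)

  double⁻ : ∀ {i} → double i ≡ true → Root.γ⁺ i ≡ true × Spoke.γ⁺ i ≡ true
  double⁻ h = ∧-true (proj₁ (∧-true h))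

  double⇒¬both : ∀ {i} → double i ≡ true → ρ i ≡ true → σ i ≡ true → ⊥
  double⇒¬both h x y =
    contradiction (trans (sym (cong not (cong₂ _∧_ x y))) (proj₂ (∧-true h))) λ ()

  -- If both walks had a last step, root and spoke would both lie strictly before `t`, so `t` would
  -- not be the first vertex to see both.
  double-last : ∀ {t u w} → double t ≡ true → r u ≡ true → p w ≡ true →
                u ↝ t → w ↝ t → t ≡ u ⊎ t ≡ w
  double-last {t} d hu hw a b = go hu hw a b refl refl
    where
    go : ∀ {k l u w} → r u ≡ true → p w ≡ true → u ↝ k → w ↝ l → t ≡ k → t ≡ l → t ≡ u ⊎ t ≡ w
    go hu hw stay       _           eq _ = inj₁ eq
    go hu hw (step a q) stay        _ eq = inj₂ eq
    go hu hw (step a q) (step b q′) refl eq = ⊥-elim (double⇒¬both d (Root.γ⁺-next q (Root.persist hu a))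
      (subst (λ z → σ z ≡ true) (sym eq) (Spoke.γ⁺-next q′ (Spoke.persist hw b))))

  module _ (one-root : ∀ i → ρ i ∧ r i ≡ false) (one-spoke : ∀ i → σ i ∧ p i ≡ false) where

    private
      double⁺ : ∀ {i} → Root.γ⁺ i ≡ true → Spoke.γ⁺ i ≡ true → ρ i ∧ σ i ≡ false → double i ≡ true
      double⁺ x y z = cong₂ _∧_ (cong₂ _∧_ x y) (cong not z)

      excluded : ∀ {x y} → x ∧ y ≡ false → y ≡ true → x ≡ false
      excluded {false} _ _ = refl
      excluded {true} eq refl = eq

    -- Both walks are shortened backwards from `j` until one is used up, at the later of `u` and
    -- `w`. The other one has been met there as well, while `one-root` or `one-spoke` shows that the
    -- one just met does not also occur earlier in the arc.
    double-exists : ∀ {u w j} → r u ≡ true → p w ≡ true → u ↝ j → w ↝ j →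
                    ∃ λ t → double t ≡ true × t ↝ j
    double-exists hu hw a b = go hu hw a b refl
      where
      go : ∀ {u w j k} → r u ≡ true → p w ≡ true → u ↝ j → w ↝ k → j ≡ k →
           ∃ λ t → double t ≡ true × t ↝ j
      go {u} hu hw stay b refl = u ,
        double⁺ (Root.from-b hu) (Spoke.persist hw b)
          (cong (_∧ σ u) (excluded (one-root u) hu)) , stay
      go {w = w} hu hw a@(step _ _) stay refl = w ,
        double⁺ (Root.persist hu a) (Spoke.from-b hw)
          (trans (cong (ρ w ∧_) (excluded (one-spoke w) hw)) (∧-zeroʳ (ρ w))) , stay
      go hu hw (step a q) (step b q′) eq with go hu hw a b (next-injective eq)
      ... | t , d , c = t , d , step c q

-- On a rim without absent edges the bit `ρ` set by the root `u` would travel all the way round and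
-- reach `u` from behind, against `one-root`.
certificate⇒cut : ∀ {N} {r p e ρ σ : Fin N → Bool} → Certificate r p e ρ σ → ∃ (λ u → r u ≡ true) →
                  ∃ λ k → e k ≡ false
certificate⇒cut {e = e} {ρ} cert (u , hu) with Fin.any? (λ k → e k ≟ᵇ false)
... | yes cut  = cut
... | no ¬cut =
  ⊥-elim (not-both (cyclic-induction (λ i → ρ i ≡ true) grow (next u , γ⁺-next (full u) (from-b hu)) u) hu)
  where
  open Certificate cert
  open Rim.Bit e _ ρ ρ-rule
  open Exclusive one-root
  full : ∀ i → e i ≡ true
  full i with e i in eq
  ... | true  = refl
  ... | false = ⊥-elim (¬cut (i , eq))
  grow : ∀ i → ρ i ≡ true → ρ (next i) ≡ true
  grow i h = γ⁺-next (full i) (from-γ h)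

-- Rooted spanning forests of the wheel

lookup-true⇒∈ : ∀ {n} {S : Subset n} {x} → Vec.lookup S x ≡ true → x ∈ S
lookup-true⇒∈ {S = S} {x} = lookup⇒[]= x S

module Wheel (N : ℕ) (N≥3 : 3 ≤ N) where

  W : Graph
  W = wheel N N≥3

  rim-ends : ∀ i → wheelEnds N (i ↑ˡ N) ≡ (suc i , suc (next i))
  rim-ends i rewrite splitAt-↑ˡ N i N = refl

  spoke-ends : ∀ i → wheelEnds N (N ↑ʳ i) ≡ (zero , suc i)
  spoke-ends i rewrite splitAt-↑ʳ N N i = refl

  rim≢spoke : ∀ i j → i ↑ˡ N ≢ N ↑ʳ j
  rim≢spoke i j eq with trans (sym (splitAt-↑ˡ N i N)) (trans (cong (splitAt N) eq) (splitAt-↑ʳ N N j))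
  ... | ()

  rimBits spokeBits : Subset (N + N) → Fin N → Bool
  rimBits   S i = Vec.lookup S (i ↑ˡ N)
  spokeBits S i = Vec.lookup S (N ↑ʳ i)

  data Link (e p : Fin N → Bool) : Fin (suc N) → Fin (suc N) → Set where
    forth   : ∀ i → e i ≡ true → Link e p (suc i) (suc (next i))
    back    : ∀ i → e i ≡ true → Link e p (suc (next i)) (suc i)
    outward : ∀ i → p i ≡ true → Link e p zero (suc i)
    inward  : ∀ i → p i ≡ true → Link e p (suc i) zero

  adjacent⇒link : ∀ {S u v} → Adjacent W S u v → Link (rimBits S) (spokeBits S) u v
  adjacent⇒link {S} {u} {v} (x , x∈ , joins) with splitAt N x in eq
  ... | inj₁ i = rim (splitAt⁻¹-↑ˡ eq) x∈ joins
    where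
    rim : ∀ {x u v} → i ↑ˡ N ≡ x → x ∈ S →
          (suc i , suc (next i)) ≡ (u , v) ⊎ (suc i , suc (next i)) ≡ (v , u) →
          Link (rimBits S) (spokeBits S) u v
    rim refl x∈ (inj₁ refl) = forth i ([]=⇒lookup x∈)
    rim refl x∈ (inj₂ refl) = back i ([]=⇒lookup x∈)
  ... | inj₂ i = spoke (splitAt⁻¹-↑ʳ eq) x∈ joins
    where
    spoke : ∀ {x u v} → N ↑ʳ i ≡ x → x ∈ S →
            (zero , suc i) ≡ (u , v) ⊎ (zero , suc i) ≡ (v , u) →
            Link (rimBits S) (spokeBits S) u v
    spoke refl x∈ (inj₁ refl) = outward i ([]=⇒lookup x∈)
    spoke refl x∈ (inj₂ refl) = inward i ([]=⇒lookup x∈)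

  rim-adjacent : ∀ {S i} → i ↑ˡ N ∈ S → Adjacent W S (suc i) (suc (next i))
  rim-adjacent {i = i} i∈ = i ↑ˡ N , i∈ , inj₁ (rim-ends i)

  spoke-adjacent : ∀ {S i} → N ↑ʳ i ∈ S → Adjacent W S (suc i) zero
  spoke-adjacent {i = i} i∈ = N ↑ʳ i , i∈ , inj₂ (spoke-ends i)

  module _ {S : Subset (N + N)} where
    open Rim (rimBits S)

    walk⇒connected : ∀ {T} → (∀ i → rimBits S i ≡ true → i ↑ˡ N ∈ T) →
                     ∀ {i j} → i ↝ j → Connected W T (suc i) (suc j)
    walk⇒connected f stay       = ε
    walk⇒connected f (step a q) = walk⇒connected f a ◅◅ (rim-adjacent (f _ q) ◅ ε)

    walk-connected : ∀ {i j} → i ↝ j → Connected W S (suc i) (suc j)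
    walk-connected = walk⇒connected λ _ → lookup-true⇒∈

    walk-connected⁻ : ∀ {i j} → i ↝ j → Connected W S (suc j) (suc i)
    walk-connected⁻ = connected-sym W ∘ walk-connected

    spoke-connected : ∀ {i} → spokeBits S i ≡ true → Connected W S (suc i) zero
    spoke-connected q = spoke-adjacent (lookup-true⇒∈ q) ◅ ε

  -- This replaces the analysis of paths: it is enough to exhibit a property that is closed under
  -- the four kinds of `Link`.
  connected-invariant : ∀ {S} {A : Fin (suc N) → Set} →
    (∀ {u v} → Link (rimBits S) (spokeBits S) u v → A u → A v) →
    ∀ {u v} → Connected W S u v → A u → A v
  connected-invariant f ε       a = a
  connected-invariant f (x ◅ c) a = connected-invariant f c (f (adjacent⇒link x) a)

  module _ {R : Subset N} {S : Subset (N + N)} where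

    private
      r e p : Fin N → Bool
      r = Vec.lookup R
      e = rimBits S
      p = spokeBits S

      root-∈ : ∀ {u} → r u ≡ true → suc u ∈ outside ∷ R
      root-∈ h = there (lookup-true⇒∈ h)

    module _ {ρ σ : Fin N → Bool} (cert : Certificate r p e ρ σ)
             {k : Fin N} (cut : e k ≡ false) where
      open Certificate cert
      open Doubling r p e ρ σ ρ-rule σ-rule
      open Cut k cut
      private
        module RootS = Root.Source k cut
        module RootX = Root.Exclusive one-root
        module SpokeS = Spoke.Source k cut
        module SpokeX = Spoke.Exclusive one-spoke

      -- Every arc is oriented towards its spoke, and rightwards if it has none.
      private
        prev : Fin N → Fin N
        prev i = proj₁ (next-surjective i)

        prev-next : ∀ i → prev (next i) ≡ i
        prev-next i = next-injective (proj₂ (next-surjective (next i)))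

        parentBy : Bool → Bool → Fin N → Fin (suc N)
        parentBy true  _     i = suc (prev i)
        parentBy false true  i = zero
        parentBy false false i = suc (next i)

        -- To the right of the spoke the rank grows with the position. To its left it falls, but
        -- stays above 1, the rank of the spoke's own vertex, because positions are below `N + N`.
        -- In an arc without spoke the last vertex gets a parent across the absent edge; this is
        -- harmless, as only present edges have to be oriented.
        rankBy : Bool → Bool → Fin N → ℕ
        rankBy true  _     i = suc (N + N + position i)
        rankBy false true  i = 1
        rankBy false false i = suc (N + N ∸ position i)

        parent : Fin (suc N) → Fin (suc N)
        parent zero    = zero
        parent (suc i) = parentBy (σ i) (p i) i

        rank : Fin (suc N) → ℕ
        rank zero    = 0
        rank (suc i) = rankBy (σ i) (p i) i

        orient-rim : ∀ i → e i ≡ true →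
          (suc (next i) ≡ parent (suc i) × rank (suc (next i)) < rank (suc i)) ⊎
          (suc i ≡ parent (suc (next i)) × rank (suc i) < rank (suc (next i)))
        orient-rim i q with σ i | p i | trans (σ-rule i) (cong (_∧ Spoke.γ⁺ i) q)
        ... | true  | _    | eq rewrite eq | prev-next i | position-next q =
          inj₂ (refl , s≤s (ℕ.+-monoʳ-< (N + N) (n<1+n _)))
        ... | false | true | eq rewrite eq | prev-next i =
          inj₂ (refl , s≤s (ℕ.<-≤-trans (ℕ.≤-<-trans z≤n (position< i)) (ℕ.m≤m+n _ _)))
        ... | false | false | eq rewrite eq = inj₁ (refl , lower (p (next i)))
          where
          lower : ∀ b → rankBy false b (next i) < suc (N + N ∸ position i)
          lower true  = s≤s (ℕ.m<n⇒0<n∸m (position< i))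
          lower false rewrite position-next q = s≤s (ℕ.∸-monoʳ-< (n<1+n _) (position< i))

        orient-spoke : ∀ i → p i ≡ true → zero ≡ parent (suc i) × 0 < rank (suc i)
        orient-spoke i h with σ i | p i | one-spoke i
        ... | false | true | _ = refl , s≤s z≤n

        orient : ∀ {u v} → Adjacent W S u v → (v ≡ parent u × rank v < rank u) ⊎
                                              (u ≡ parent v × rank u < rank v)
        orient a with adjacent⇒link a
        ... | forth i q   = orient-rim i q
        ... | back i q    = swap (orient-rim i q)
        ... | outward i h = inj₂ (orient-spoke i h)
        ... | inward i h  = inj₁ (orient-spoke i h)

        t₀ : Fin N
        t₀ = proj₁ one-double
        double-t₀ : double t₀ ≡ true
        double-t₀ = proj₁ (proj₂ one-double)

        centreRoot : ∃ λ u → r u ≡ true × u ↝ t₀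
        centreRoot = RootS.source (proj₁ (double⁻ double-t₀))

        u₀ : Fin N
        u₀ = proj₁ centreRoot

        centre-connected : Connected W S zero (suc u₀)
        centre-connected with SpokeS.source (proj₂ (double⁻ double-t₀))
        ... | w , h , a = connected-sym W (spoke-connected {S} h) ◅◅
          walk-connected {S} a ◅◅ walk-connected⁻ {S} (proj₂ (proj₂ centreRoot))

        RootOf : Fin N → Fin N → Set
        RootOf j u = (r u ≡ true × u ↝ j) ⊎ (Root.γ⁺ j ≡ false × u ≡ u₀)

        rootOf : ∀ j → ∃ (RootOf j)
        rootOf j with Root.γ⁺ j in eq
        ... | true  = let u , h , a = RootS.source eq in u , inj₁ (h , a)
        ... | false = u₀ , inj₂ (refl , refl)

        -- The choice is made at the end of the arc, so that it is visibly the same for all vertices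
        -- of one arc.
        root : Fin (suc N) → Fin N
        root zero    = u₀
        root (suc i) = proj₁ (rootOf (proj₁ (end i)))

        root-isRoot : ∀ v → r (root v) ≡ true
        root-isRoot zero    = proj₁ (proj₂ centreRoot)
        root-isRoot (suc i) with rootOf (proj₁ (end i))
        ... | _ , inj₁ (h , _)    = h
        ... | _ , inj₂ (_ , refl) = proj₁ (proj₂ centreRoot)

        root-connected : ∀ v → Connected W S v (suc (root v))
        root-connected zero    = centre-connected
        root-connected (suc i) with end i
        ... | j , a , q with rootOf j
        ...   | u , inj₁ (_ , b) = walk-connected {S} a ◅◅ walk-connected⁻ {S} b
        ...   | _ , inj₂ (no-root , refl)
          with SpokeS.source (trans (sym (cong (_∨ Spoke.γ⁺ j) no-root)) (anchored j q))
        ...     | w , h , b =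
            walk-connected {S} a ◅◅ walk-connected⁻ {S} b ◅◅ spoke-connected {S} h ◅◅ centre-connected

        -- An arc with this spoke and a root contains a doubling. There is only one, at `t₀`, so the
        -- root is `u₀`.
        root-spoke : ∀ i → p i ≡ true → root (suc i) ≡ u₀
        root-spoke i h with end i
        ... | j , a , q with rootOf j
        ...   | u , inj₂ (_ , eq) = eq
        ...   | u , inj₁ (g , b) with double-exists one-root one-spoke g h b a
        ...     | t , d , c with proj₂ (proj₂ one-double) d
        ...       | refl = RootX.source-unique g (proj₁ (proj₂ centreRoot)) b
                             (↝-trans (proj₂ (proj₂ centreRoot)) c)

        root-rim : ∀ i → e i ≡ true → root (suc i) ≡ root (suc (next i))
        root-rim i q with end i | end (next i)
        ... | j , a , q₁ | j′ , b , q₂ =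
          cong (proj₁ ∘ rootOf) (end-unique a q₁ (step-first q b) q₂)

        root-link : ∀ {u v} → Link e p u v → root u ≡ root v
        root-link (forth i q)   = root-rim i q
        root-link (back i q)    = sym (root-rim i q)
        root-link (outward i h) = sym (root-spoke i h)
        root-link (inward i h)  = root-spoke i h

        root-root : ∀ {u} → r u ≡ true → root (suc u) ≡ u
        root-root {u} h with end u
        ... | j , a , q with rootOf j
        ...   | u′ , inj₁ (g , b) = RootX.source-unique g h b a
        ...   | _ , inj₂ (no-root , _) = contradiction (trans (sym no-root) (Root.persist h a)) λ ()

      certificate⇒forest : RootedSpanningForest W (outside ∷ R) S
      certificate⇒forest = acyclic-by-rank W parent rank orient , λ v →
        suc (root v) , (root-∈ (root-isRoot v) , root-connected v) , unique v
        where
        unique : ∀ v {x} → x ∈ outside ∷ R × Connected W S v x → suc (root v) ≡ x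
        unique v {suc u} (there u∈ , c) = cong suc (trans
          (connected-invariant {A = λ x → root v ≡ root x} (λ l eq → trans eq (root-link l)) c refl)
          (root-root ([]=⇒lookup u∈)))

    acyclic⇒cut : Acyclic W S → ∃ λ k → e k ≡ false
    acyclic⇒cut acyclic with Fin.any? (λ k → e k ≟ᵇ false)
    ... | yes cut  = cut
    ... | no ¬cut = ⊥-elim (edge-not-in-cycle W acyclic (full l) (inj₂ (rim-ends l)) detour)
      where
      l : Fin N
      l = Fin.fromℕ< (≤-trans (s≤s z≤n) N≥3)
      full : ∀ i → i ↑ˡ N ∈ S
      full i with e i in eq
      ... | true  = lookup-true⇒∈ eq
      ... | false = ⊥-elim (¬cut (i , eq))
      detour : Connected W (S - (l ↑ˡ N)) (suc (next l)) (suc l)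
      -- The induction starts at `next l` and goes once around. The only step over the removed edge
      -- leads from `l` to `next l`, where the empty walk will do.
      detour = cyclic-induction (λ j → Connected W (S - (l ↑ˡ N)) (suc (next l)) (suc j)) extend (next l , ε) l
        where
        extend : ∀ j → Connected W (S - (l ↑ˡ N)) (suc (next l)) (suc j) →
                 Connected W (S - (l ↑ˡ N)) (suc (next l)) (suc (next j))
        extend j c with j Fin.≟ l
        ... | yes refl = ε
        ... | no j≢l   = c ◅◅ rim-adjacent (x∈p∧x≢y⇒x∈p-y (full j) (j≢l ∘ ↑ˡ-injective N j l)) ◅ ε

    module _ (forest : RootedSpanningForest W (outside ∷ R) S) where

      private
        acyclic : Acyclic W S
        acyclic = proj₁ forest

        same-root : ∀ {v u u′} → r u ≡ true → r u′ ≡ true →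
                    Connected W S v (suc u) → Connected W S v (suc u′) → u ≡ u′
        same-root {v} h h′ c c′ = Fin.suc-injective
          (trans (sym (unique (root-∈ h , c))) (unique (root-∈ h′ , c′)))
          where
          unique : ∀ {x} → x ∈ outside ∷ R × Connected W S v x → proj₁ (proj₂ forest v) ≡ x
          unique = proj₂ (proj₂ (proj₂ forest v))

        no-spoke-detour : ∀ {w w′} → p w ≡ true → p w′ ≡ true → w ≢ w′ →
          ¬ Connected W (S - (N ↑ʳ w)) (suc w) (suc w′)
        no-spoke-detour {w} {w′} h h′ w≢w′ c =
          edge-not-in-cycle W acyclic (lookup-true⇒∈ h) (inj₂ (spoke-ends w))
            (c ◅◅ spoke-adjacent (x∈p∧x≢y⇒x∈p-y (lookup-true⇒∈ h′) (w≢w′ ∘ sym ∘ ↑ʳ-injective N w′ w)) ◅ ε)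

        rim-walk : ∀ {w i j} → Rim._↝_ e i j → Connected W (S - (N ↑ʳ w)) (suc i) (suc j)
        rim-walk {w} = walk⇒connected {S} λ i q → x∈p∧x≢y⇒x∈p-y (lookup-true⇒∈ q) (rim≢spoke i w)

      module _ {ρ σ : Fin N → Bool}
               (ρ-rule : ∀ i → ρ (next i) ≡ e i ∧ (ρ i ∨ r i))
               (σ-rule : ∀ i → σ (next i) ≡ e i ∧ (σ i ∨ p i)) where
        open Doubling r p e ρ σ ρ-rule σ-rule
        private
          k : Fin N
          k = proj₁ (acyclic⇒cut acyclic)
          cut : e k ≡ false
          cut = proj₂ (acyclic⇒cut acyclic)
          open Cut k cut
          module RootS = Root.Source k cut
          module SpokeS = Spoke.Source k cut

          one-root : ∀ i → ρ i ∧ r i ≡ false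
          one-root i with ρ i in eq₁ | r i in eq₂
          ... | false | _     = refl
          ... | true  | false = refl
          ... | true  | true  with RootS.source-before eq₁
          ...   | u , h , a , u≢i = contradiction (same-root h eq₂ ε (walk-connected {S} a)) u≢i

          -- Two spokes of one arc would close a cycle through the centre.
          one-spoke : ∀ i → σ i ∧ p i ≡ false
          one-spoke i with σ i in eq₁ | p i in eq₂
          ... | false | _     = refl
          ... | true  | false = refl
          ... | true  | true  with SpokeS.source-before eq₁
          ...   | w , h , a , w≢i = ⊥-elim (no-spoke-detour h eq₂ w≢i (rim-walk a))

          anchored : ∀ j → e j ≡ false → (ρ j ∨ r j) ∨ (σ j ∨ p j) ≡ true
          anchored j q with Root.γ⁺ j in no-root | Spoke.γ⁺ j in no-spoke
          ... | true  | _    = refl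
          ... | false | true = refl
          ... | false | false = ⊥-elim (no-root-in-arc (proj₁ (proj₂ (proj₂ forest (suc j)))))
            where
            -- The arc ending in `j`. Without a spoke it is closed under all links, hence a union of
            -- components, and a root in it would make `Root.γ⁺ j` true.
            A : Fin (suc N) → Set
            A zero    = ⊥
            A (suc i) = i ↝ j
            closed : ∀ {u v} → Link e p u v → A u → A v
            closed (forth i q′) a with first-step a
            ... | inj₁ refl    = contradiction (trans (sym q′) q) λ ()
            ... | inj₂ (_ , b) = b
            closed (back i q′) a  = step-first q′ a
            closed (inward i h) a = contradiction (trans (sym no-spoke) (Spoke.persist h a)) λ ()
            no-root-in-arc : ∀ {x} → ¬ (x ∈ outside ∷ R × Connected W S (suc j) x)
            no-root-in-arc {suc u} (there u∈ , c) = contradiction (trans (sym no-root)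
              (Root.persist ([]=⇒lookup u∈) (connected-invariant {A = A} closed c stay))) λ ()

          some-double : ∃ λ t → double t ≡ true
          some-double = find (proj₁ (proj₂ (proj₂ forest zero)))
            where
            -- The centre together with all arcs that have a spoke. This set contains the component
            -- of the centre, hence the centre's root, whose arc therefore has both a root and a
            -- spoke.
            A : Fin (suc N) → Set
            A zero    = ⊤
            A (suc i) = ∃ λ w → p w ≡ true × (i ↝ w ⊎ w ↝ i)
            closed : ∀ {u v} → Link e p u v → A u → A v
            closed (forth i q) (w , h , inj₂ a) = w , h , inj₂ (step a q)
            closed (forth i q) (w , h , inj₁ a) with first-step a
            ... | inj₁ refl    = w , h , inj₂ (step stay q)
            ... | inj₂ (_ , b) = w , h , inj₁ b
            closed (back i q) (w , h , inj₁ a) = w , h , inj₁ (step-first q a)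
            closed (back i q) (w , h , inj₂ a) = w , h , last-step a refl
              where
              last-step : ∀ {j} → w ↝ j → j ≡ next i → i ↝ w ⊎ w ↝ i
              last-step stay       refl = inj₁ (step stay q)
              last-step (step a _) eq   = inj₂ (subst (w ↝_) (next-injective eq) a)
            closed (outward i h) _ = i , h , inj₁ stay
            closed (inward i h)  _ = tt
            find : ∀ {x} → x ∈ outside ∷ R × Connected W S zero x → ∃ λ t → double t ≡ true
            find {suc u} (there u∈ , c) with connected-invariant {A = A} closed c tt
            ... | w , h , inj₁ b with double-exists one-root one-spoke ([]=⇒lookup u∈) h b stay
            ...   | t , d , _ = t , d
            find {suc u} (there u∈ , c) | w , h , inj₂ b
              with double-exists one-root one-spoke ([]=⇒lookup u∈) h stay b
            ...   | t , d , _ = t , d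

          -- Both arcs reach the centre through their spokes, so they share their root. Different
          -- spokes would then close a cycle through that root and the centre, so the spoke is
          -- shared too, and by `double-last` each of `t` and `t′` is the vertex of the root or of
          -- the spoke.
          double-unique : ∀ {t t′} → double t ≡ true → double t′ ≡ true → t ≡ t′
          double-unique {t} {t′} d d′
            with RootS.source (proj₁ (double⁻ d)) | SpokeS.source (proj₂ (double⁻ d))
               | RootS.source (proj₁ (double⁻ d′)) | SpokeS.source (proj₂ (double⁻ d′))
          ... | u , g , a | w , h , b | u′ , g′ , a′ | w′ , h′ , b′
            with same-root g g′
                   (connected-sym W (spoke-connected {S} h) ◅◅ walk-connected {S} b ◅◅ walk-connected⁻ {S} a)
                   (connected-sym W (spoke-connected {S} h′) ◅◅ walk-connected {S} b′ ◅◅ walk-connected⁻ {S} a′)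
          ...   | refl with w Fin.≟ w′
          ...     | no w≢w′ = ⊥-elim (no-spoke-detour h h′ w≢w′
                      (rim-walk b ◅◅ connected-sym W (rim-walk a) ◅◅ rim-walk a′ ◅◅ connected-sym W (rim-walk b′)))
          ...     | yes refl with double-last d g h a b | double-last d′ g h a′ b′
          ...       | inj₁ refl | inj₁ refl = refl
          ...       | inj₂ refl | inj₂ refl = refl
          ...       | inj₁ refl | inj₂ refl = ↝-antisym a′ b
          ...       | inj₂ refl | inj₁ refl = ↝-antisym b′ a

        forest⇒certificate : Certificate r p e ρ σ
        forest⇒certificate = record
          { ρ-rule = ρ-rule ; σ-rule = σ-rule ; one-root = one-root ; one-spoke = one-spoke
          ; anchored = anchored
          ; one-double = proj₁ some-double , proj₂ some-double , double-unique (proj₂ some-double) }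

-- Runs along the rim

∑ᵇ : (Bool → ℕ) → ℕ
∑ᵇ f = f false + f true

∑ᵛ : ∀ n → (Vec Bool n → ℕ) → ℕ
∑ᵛ zero    f = f []
∑ᵛ (suc n) f = ∑ᵇ λ b → ∑ᵛ n λ v → f (b ∷ v)

∑ᵇ-cong : ∀ {f g} → (∀ b → f b ≡ g b) → ∑ᵇ f ≡ ∑ᵇ g
∑ᵇ-cong h = cong₂ _+_ (h false) (h true)

∑ᵛ-cong : ∀ n {f g} → (∀ v → f v ≡ g v) → ∑ᵛ n f ≡ ∑ᵛ n g
∑ᵛ-cong zero    h = h []
∑ᵛ-cong (suc n) h = ∑ᵇ-cong λ b → ∑ᵛ-cong n λ v → h (b ∷ v)

+-interchange : ∀ a b c d → (a + b) + (c + d) ≡ (a + c) + (b + d)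
+-interchange = solve-∀

∑ᵛ-+ : ∀ n f g → ∑ᵛ n (λ v → f v + g v) ≡ ∑ᵛ n f + ∑ᵛ n g
∑ᵛ-+ zero    f g = refl
∑ᵛ-+ (suc n) f g =
  trans (∑ᵇ-cong λ b → ∑ᵛ-+ n (f ∘ (b ∷_)) (g ∘ (b ∷_))) (+-interchange (∑ᵛ n (f ∘ (false ∷_))) _ _ _)

∑ᵛ-∑ᵇ : ∀ n (f : Bool → Vec Bool n → ℕ) → ∑ᵛ n (λ v → ∑ᵇ λ b → f b v) ≡ ∑ᵇ λ b → ∑ᵛ n (f b)
∑ᵛ-∑ᵇ n f = ∑ᵛ-+ n (f false) (f true)

∑ᵛ-zero : ∀ n → ∑ᵛ n (λ _ → 0) ≡ 0
∑ᵛ-zero zero    = refl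
∑ᵛ-zero (suc n) = cong₂ _+_ (∑ᵛ-zero n) (∑ᵛ-zero n)

∑ᵛ-++ : ∀ m {n} f → ∑ᵛ (m + n) f ≡ ∑ᵛ m λ v → ∑ᵛ n λ w → f (v Vec.++ w)
∑ᵛ-++ zero    f = refl
∑ᵛ-++ (suc m) f = ∑ᵇ-cong λ b → ∑ᵛ-++ m (f ∘ (b ∷_))

bit : Bool → ℕ
bit false = 0
bit true  = 1

length-filter-allSubsets : ∀ {n} {P : Subset n → Set} (P? : ∀ S → Dec (P S)) →
  length (filter P? (allSubsets n)) ≡ ∑ᵛ n (bit ∘ Dec.does ∘ P?)
length-filter-allSubsets {zero} P? with Dec.does (P? [])
... | false = refl
... | true  = refl
length-filter-allSubsets {suc n} P? = begin
  length (filter P? (map (outside ∷_) xs ++ map (inside ∷_) xs))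
    ≡⟨ cong length (filter-++ P? (map (outside ∷_) xs) _) ⟩
  length (filter P? (map (outside ∷_) xs) ++ filter P? (map (inside ∷_) xs))
    ≡⟨ length-++ (filter P? (map (outside ∷_) xs)) ⟩
  length (filter P? (map (outside ∷_) xs)) + length (filter P? (map (inside ∷_) xs))
    ≡⟨ cong₂ _+_ (length-filter-map xs) (length-filter-map xs) ⟩
  length (filter (P? ∘ (outside ∷_)) xs) + length (filter (P? ∘ (inside ∷_)) xs)
    ≡⟨ cong₂ _+_ (length-filter-allSubsets (P? ∘ (outside ∷_))) (length-filter-allSubsets (P? ∘ (inside ∷_))) ⟩
  ∑ᵛ (suc n) (bit ∘ Dec.does ∘ P?) ∎
  where
  open ≡-Reasoning
  xs = allSubsets n
  length-filter-map : ∀ {b} ys → length (filter P? (map (b ∷_) ys)) ≡ length (filter (P? ∘ (b ∷_)) ys)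
  length-filter-map [] = refl
  length-filter-map {b} (y ∷ ys) with Dec.does (P? (b ∷ y))
  ... | false = length-filter-map ys
  ... | true  = cong suc (length-filter-map ys)

-- The pair (ρ , σ) of a Certificate.
Content : Set
Content = Bool × Bool

_≡ᵇ_ : Bool → Bool → Bool
false ≡ᵇ y = not y
true  ≡ᵇ y = y

≡ᵇ⇒≡ : ∀ {x y} → x ≡ᵇ y ≡ true → x ≡ y
≡ᵇ⇒≡ {false} {false} _ = refl
≡ᵇ⇒≡ {true}  {true}  _ = refl

≡ᵇ-refl : ∀ x → x ≡ᵇ x ≡ true
≡ᵇ-refl false = refl
≡ᵇ-refl true  = refl

same : Content → Content → Bool
same (ρ , σ) (ρ′ , σ′) = (ρ ≡ᵇ ρ′) ∧ (σ ≡ᵇ σ′)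

admissible : Content → (r p e : Bool) → Bool
admissible (ρ , σ) r p e = (not (ρ ∧ r) ∧ not (σ ∧ p)) ∧ (e ∨ ((ρ ∨ r) ∨ (σ ∨ p)))

advance : Content → (r p e : Bool) → Content
advance (ρ , σ) r p e = e ∧ (ρ ∨ r) , e ∧ (σ ∨ p)

doubling : Content → (r p : Bool) → Bool
doubling (ρ , σ) = doubles ρ σ

accepts : ∀ {n} → Bool → Content → (R P E : Vec Bool n) → Content → Bool
accepts t c []      []      []      c′ = not t ∧ same c c′
accepts t c (r ∷ R) (p ∷ P) (e ∷ E) c′ =
  (admissible c r p e ∧ (not (doubling c r p) ∨ t)) ∧
  accepts (t ∧ not (doubling c r p)) (advance c r p e) R P E c′

content : ∀ {n} → Content → (R P E : Vec Bool n) → ℕ → Content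
content c R       P       E       zero    = c
content c []      []      []      (suc m) = c
content c (r ∷ R) (p ∷ P) (e ∷ E) (suc m) = content (advance c r p e) R P E m

content-suc : ∀ {n} c (R P E : Vec Bool n) i → content c R P E (suc (toℕ i)) ≡
  advance (content c R P E (toℕ i)) (Vec.lookup R i) (Vec.lookup P i) (Vec.lookup E i)
content-suc c (r ∷ R) (p ∷ P) (e ∷ E) zero    = refl
content-suc c (r ∷ R) (p ∷ P) (e ∷ E) (suc i) = content-suc (advance c r p e) R P E i

-- An absent edge sends every content to `(false , false)`; what follows no longer depends on the
-- start.
content-reset : ∀ {n} (R P E : Vec Bool n) k → Vec.lookup E k ≡ false →
                ∀ c c′ → content c R P E n ≡ content c′ R P E n
content-reset (r ∷ R) (p ∷ P) (.false ∷ E) zero    refl c c′ = refl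
content-reset (r ∷ R) (p ∷ P) (e ∷ E)      (suc k) q    c c′ = content-reset R P E k q _ _

Exactly : ∀ {n} → Bool → (Fin n → Bool) → Set
Exactly true  f = ∃! _≡_ λ i → f i ≡ true
Exactly false f = ∀ i → f i ≡ false

exactly-∷⁺ : ∀ {n} t (f : Fin (suc n) → Bool) → not (f zero) ∨ t ≡ true →
             Exactly (t ∧ not (f zero)) (f ∘ suc) → Exactly t f
exactly-∷⁺ t f le once with f zero in eq
exactly-∷⁺ false f le none | false = λ { zero → eq ; (suc i) → none i }
exactly-∷⁺ true f le (i , h , u) | false = suc i , h , unique _
  where
  unique : ∀ j → f j ≡ true → suc i ≡ j
  unique zero    h′ = contradiction (trans (sym eq) h′) λ ()
  unique (suc j) h′ = cong suc (u h′)
exactly-∷⁺ true f le none | true = zero , eq , unique _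
  where
  unique : ∀ j → f j ≡ true → zero ≡ j
  unique zero    h′ = refl
  unique (suc j) h′ = contradiction (trans (sym (none j)) h′) λ ()

exactly-∷⁻ : ∀ {n} t (f : Fin (suc n) → Bool) → Exactly t f →
             not (f zero) ∨ t ≡ true × Exactly (t ∧ not (f zero)) (f ∘ suc)
exactly-∷⁻ false f none rewrite none zero = refl , none ∘ suc
exactly-∷⁻ true f (i , h , u) with f zero in eq
exactly-∷⁻ true f (zero , h , u) | false = contradiction (trans (sym h) eq) λ ()
exactly-∷⁻ true f (suc i , h , u) | false = refl , i , h , λ h′ → Fin.suc-injective (u h′)
... | true = refl , none
  where
  none : ∀ j → f (suc j) ≡ false
  none j with f (suc j) in eq′
  ... | false = refl
  ... | true  with trans (sym (u eq)) (u eq′)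
  ...   | ()

record Accepting {n} (t : Bool) (c : Content) (R P E : Vec Bool n) (c′ : Content) : Set where
  private
    at : Fin n → Content
    at i = content c R P E (toℕ i)
  field
    all-admissible : ∀ i → admissible (at i) (Vec.lookup R i) (Vec.lookup P i) (Vec.lookup E i) ≡ true
    doubling-count : Exactly t λ i → doubling (at i) (Vec.lookup R i) (Vec.lookup P i)
    final          : content c R P E n ≡ c′

accepts⇒accepting : ∀ {n} t c (R P E : Vec Bool n) c′ → accepts t c R P E c′ ≡ true → Accepting t c R P E c′
accepts⇒accepting false c [] [] [] c′ h = record
  { all-admissible = λ () ; doubling-count = λ ()
  ; final = let x , y = ∧-true h in cong₂ _,_ (≡ᵇ⇒≡ x) (≡ᵇ⇒≡ y) }
accepts⇒accepting true c [] [] [] c′ ()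
accepts⇒accepting t c (r ∷ R) (p ∷ P) (e ∷ E) c′ h with ∧-true h
... | g , h′ with ∧-true g | accepts⇒accepting _ _ R P E c′ h′
...   | ok , le | acc = record
  { all-admissible = λ { zero → ok ; (suc i) → Accepting.all-admissible acc i }
  ; doubling-count = exactly-∷⁺ t _ le (Accepting.doubling-count acc)
  ; final = Accepting.final acc }

accepting⇒accepts : ∀ {n} t c (R P E : Vec Bool n) c′ → Accepting t c R P E c′ → accepts t c R P E c′ ≡ true
accepting⇒accepts t c [] [] [] c′ acc with Accepting.final acc | t | Accepting.doubling-count acc
... | refl | false | _ = cong₂ _∧_ (≡ᵇ-refl (proj₁ c)) (≡ᵇ-refl (proj₂ c))
... | refl | true | () , _
accepting⇒accepts t c (r ∷ R) (p ∷ P) (e ∷ E) c′ acc with exactly-∷⁻ t _ (Accepting.doubling-count acc)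
... | le , once = cong₂ _∧_ (cong₂ _∧_ (Accepting.all-admissible acc zero) le)
  (accepting⇒accepts _ _ R P E c′ record
    { all-admissible = Accepting.all-admissible acc ∘ suc
    ; doubling-count = once
    ; final = Accepting.final acc })

module _ {N : ℕ} {R P E : Vec Bool N} {c : Content} where

  private
    r p e ρ σ : Fin N → Bool
    r = Vec.lookup R
    p = Vec.lookup P
    e = Vec.lookup E
    ρ i = proj₁ (content c R P E (toℕ i))
    σ i = proj₂ (content c R P E (toℕ i))

  content-next : content c R P E N ≡ c → ∀ i →
    content c R P E (toℕ (next i)) ≡ advance (content c R P E (toℕ i)) (r i) (p i) (e i)
  content-next closed i with toℕ-next i
  ... | inj₁ (_ , eq) = trans (cong (content c R P E) eq) (content-suc c R P E i)
  ... | inj₂ (s , eq) = trans (cong (content c R P E) eq) (trans (sym closed)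
                          (trans (cong (content c R P E) (sym s)) (content-suc c R P E i)))

  private
    admissible⁻ : ∀ {c} r p e → admissible c r p e ≡ true →
      proj₁ c ∧ r ≡ false × proj₂ c ∧ p ≡ false × (e ≡ false → (proj₁ c ∨ r) ∨ (proj₂ c ∨ p) ≡ true)
    admissible⁻ {ρ , σ} r p e h with ∧-true h
    ... | g , a with ∧-true g
    ...   | x , y = not-true x , not-true y , λ { refl → a }
      where
      not-true : ∀ {x} → not x ≡ true → x ≡ false
      not-true {false} _ = refl

    admissible⁺ : ∀ c r p e → proj₁ c ∧ r ≡ false → proj₂ c ∧ p ≡ false →
      (e ≡ false → (proj₁ c ∨ r) ∨ (proj₂ c ∨ p) ≡ true) → admissible c r p e ≡ true
    admissible⁺ c r p true  x y z = cong₂ _∧_ (cong₂ _∧_ (cong not x) (cong not y)) refl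
    admissible⁺ c r p false x y z = cong₂ _∧_ (cong₂ _∧_ (cong not x) (cong not y)) (z refl)

  accepting⇒certificate : Accepting true c R P E c → Certificate r p e ρ σ
  accepting⇒certificate acc = record
    { ρ-rule     = λ i → cong proj₁ (content-next final i)
    ; σ-rule     = λ i → cong proj₂ (content-next final i)
    ; one-root   = λ i → proj₁ (local i)
    ; one-spoke  = λ i → proj₁ (proj₂ (local i))
    ; anchored   = λ i → proj₂ (proj₂ (local i))
    ; one-double = doubling-count }
    where
    open Accepting acc
    local = λ i → admissible⁻ (r i) (p i) (e i) (all-admissible i)

  certificate⇒accepting : content c R P E N ≡ c → Certificate r p e ρ σ → Accepting true c R P E c
  certificate⇒accepting closed cert = record
    { all-admissible = λ i → admissible⁺ _ (r i) (p i) (e i) (one-root i) (one-spoke i) (anchored i)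
    ; doubling-count = one-double
    ; final          = closed }
    where open Certificate cert

-- Transfer matrices

certificate-cong : ∀ {N} {r p p′ e e′ ρ σ : Fin N → Bool} → (∀ i → p i ≡ p′ i) → (∀ i → e i ≡ e′ i) →
                   Certificate r p e ρ σ → Certificate r p′ e′ ρ σ
certificate-cong {r = r} {p} {p′} {e} {e′} {ρ} {σ} p≗ e≗ cert = record
  { ρ-rule     = λ i → trans (ρ-rule i) (cong (_∧ (ρ i ∨ r i)) (e≗ i))
  ; σ-rule     = λ i → trans (σ-rule i) (cong₂ (λ x y → x ∧ (σ i ∨ y)) (e≗ i) (p≗ i))
  ; one-root   = one-root
  ; one-spoke  = λ i → trans (cong (σ i ∧_) (sym (p≗ i))) (one-spoke i)
  ; anchored   = λ i q → trans (cong (λ y → (ρ i ∨ r i) ∨ (σ i ∨ y)) (sym (p≗ i)))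
                               (anchored i (trans (e≗ i) q))
  ; one-double = let t , d , u = one-double in
      t , trans (sym (double≗ t)) d , λ {j} d′ → u (trans (double≗ j) d′) }
  where
  open Certificate cert
  double≗ : ∀ i → doubles (ρ i) (σ i) (r i) (p i) ≡ doubles (ρ i) (σ i) (r i) (p′ i)
  double≗ i = cong (doubles (ρ i) (σ i) (r i)) (p≗ i)

bit-unique : ∀ (g : Content → Bool) c → g c ≡ true → (∀ c′ → g c′ ≡ true → c′ ≡ c) →
             ∑ᵇ (λ ρ → ∑ᵇ λ σ → bit (g (ρ , σ))) ≡ 1
bit-unique g c h u
  with g (false , false) in eq₀ | g (false , true) in eq₁ | g (true , false) in eq₂ | g (true , true) in eq₃
... | true  | false | false | false = refl
... | false | true  | false | false = refl
... | false | false | true  | false = refl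
... | false | false | false | true  = refl
... | true  | true  | _     | _     = contradiction (trans (u _ eq₀) (sym (u _ eq₁))) λ ()
... | true  | false | true  | _     = contradiction (trans (u _ eq₀) (sym (u _ eq₂))) λ ()
... | true  | false | false | true  = contradiction (trans (u _ eq₀) (sym (u _ eq₃))) λ ()
... | false | true  | true  | _     = contradiction (trans (u _ eq₁) (sym (u _ eq₂))) λ ()
... | false | true  | false | true  = contradiction (trans (u _ eq₁) (sym (u _ eq₃))) λ ()
... | false | false | true  | true  = contradiction (trans (u _ eq₂) (sym (u _ eq₃))) λ ()
... | false | false | false | false = contradiction (trans (sym (value c)) h) λ ()
  where
  value : ∀ c → g c ≡ false
  value (false , false) = eq₀
  value (false , true)  = eq₁
  value (true  , false) = eq₂
  value (true  , true)  = eq₃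

bit-none : ∀ (g : Content → Bool) → (∀ c → g c ≢ true) → ∑ᵇ (λ ρ → ∑ᵇ λ σ → bit (g (ρ , σ))) ≡ 0
bit-none g none = cong₂ _+_ (cong₂ _+_ (zero-at _) (zero-at _)) (cong₂ _+_ (zero-at _) (zero-at _))
  where
  zero-at : ∀ c → bit (g c) ≡ 0
  zero-at c with g c | none c
  ... | false | _ = refl
  ... | true  | n = contradiction refl n

module _ (N : ℕ) (N≥3 : 3 ≤ N) (R : Subset N) (nonempty : ∃ λ u → Vec.lookup R u ≡ true) where
  open Wheel N N≥3

  module _ (E P : Vec Bool N) where

    private
      S : Subset (N + N)
      S = E Vec.++ P

      rim≗ : ∀ i → Vec.lookup E i ≡ rimBits S i
      rim≗ i = sym (lookup-++ˡ E P i)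

      spoke≗ : ∀ i → Vec.lookup P i ≡ spokeBits S i
      spoke≗ i = sym (lookup-++ʳ E P i)

    accepts⇒forest : ∀ c → accepts true c R P E c ≡ true → RootedSpanningForest W (outside ∷ R) S
    accepts⇒forest c h = certificate⇒forest cert (proj₂ (certificate⇒cut cert nonempty))
      where cert = certificate-cong spoke≗ rim≗ (accepting⇒certificate (accepts⇒accepting true c R P E c h))

    -- A forest leaves out a rim edge, so one turn around the rim ends in the same content `c` from
    -- wherever it starts. Hence `c` returns to itself and is the only content that does; this is
    -- why each forest is counted exactly once below.
    forest⇒accepts : RootedSpanningForest W (outside ∷ R) S →
      ∃ λ c → accepts true c R P E c ≡ true × (∀ c′ → accepts true c′ R P E c′ ≡ true → c′ ≡ c)
    forest⇒accepts forest = c , accepting⇒accepts true c R P E c acc , λ c′ h → begin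
      c′                      ≡⟨ Accepting.final (accepts⇒accepting true c′ R P E c′ h) ⟨
      content c′ R P E N      ≡⟨ reset c′ (false , false) ⟩
      c                       ∎
      where
      open ≡-Reasoning
      k = proj₁ (acyclic⇒cut {R} {S} (proj₁ forest))
      reset = content-reset R P E k (trans (rim≗ k) (proj₂ (acyclic⇒cut {R} {S} (proj₁ forest))))
      c = content (false , false) R P E N
      closed : content c R P E N ≡ c
      closed = reset c (false , false)
      cert = forest⇒certificate {R} {S} forest
        (λ i → trans (cong proj₁ (content-next closed i))
                     (cong (_∧ (proj₁ (content c R P E (toℕ i)) ∨ Vec.lookup R i)) (rim≗ i)))
        (λ i → trans (cong proj₂ (content-next closed i))
                     (cong₂ (λ x y → x ∧ (proj₂ (content c R P E (toℕ i)) ∨ y)) (rim≗ i) (spoke≗ i)))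
      acc : Accepting true c R P E c
      acc = certificate⇒accepting closed (certificate-cong (sym ∘ spoke≗) (sym ∘ rim≗) cert)

    forest-bit : bit (Dec.does (rootedSpanningForest? W (outside ∷ R) S)) ≡
                 ∑ᵇ λ ρ → ∑ᵇ λ σ → bit (accepts true (ρ , σ) R P E (ρ , σ))
    forest-bit = by-cases (rootedSpanningForest? W (outside ∷ R) S)
      where
      by-cases : (d : Dec (RootedSpanningForest W (outside ∷ R) S)) → bit (Dec.does d) ≡
                 ∑ᵇ λ ρ → ∑ᵇ λ σ → bit (accepts true (ρ , σ) R P E (ρ , σ))
      by-cases (yes forest) = let c , h , u = forest⇒accepts forest in
        sym (bit-unique (λ c → accepts true c R P E c) c h u)
      by-cases (no ¬forest) = sym (bit-none (λ c → accepts true c R P E c) λ c h → ¬forest (accepts⇒forest c h))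

  ℱ-wheel-accepts : ℱ-wheel N N≥3 R ≡ ∑ᵇ λ ρ → ∑ᵇ λ σ →
    ∑ᵛ N λ E → ∑ᵛ N λ P → bit (accepts true (ρ , σ) R P E (ρ , σ))
  ℱ-wheel-accepts = begin
    ℱ-wheel N N≥3 R
      ≡⟨ length-filter-allSubsets (rootedSpanningForest? W (outside ∷ R)) ⟩
    ∑ᵛ (N + N) (bit ∘ Dec.does ∘ rootedSpanningForest? W (outside ∷ R))
      ≡⟨ ∑ᵛ-++ N _ ⟩
    ∑ᵛ N (λ E → ∑ᵛ N λ P → bit (Dec.does (rootedSpanningForest? W (outside ∷ R) (E Vec.++ P))))
      ≡⟨ ∑ᵛ-cong N (λ E → ∑ᵛ-cong N λ P → forest-bit E P) ⟩
    ∑ᵛ N (λ E → ∑ᵛ N λ P → ∑ᵇ λ ρ → ∑ᵇ λ σ → g ρ σ E P)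
      ≡⟨ ∑ᵛ-cong N (λ E → trans (∑ᵛ-∑ᵇ N λ ρ P → ∑ᵇ λ σ → g ρ σ E P)
                                (∑ᵇ-cong λ ρ → ∑ᵛ-∑ᵇ N λ σ P → g ρ σ E P)) ⟩
    ∑ᵛ N (λ E → ∑ᵇ λ ρ → ∑ᵇ λ σ → ∑ᵛ N λ P → g ρ σ E P)
      ≡⟨ trans (∑ᵛ-∑ᵇ N λ ρ E → ∑ᵇ λ σ → ∑ᵛ N (g ρ σ E))
               (∑ᵇ-cong λ ρ → ∑ᵛ-∑ᵇ N λ σ E → ∑ᵛ N (g ρ σ E)) ⟩
    ∑ᵇ (λ ρ → ∑ᵇ λ σ → ∑ᵛ N λ E → ∑ᵛ N λ P → g ρ σ E P) ∎
    where
    open ≡-Reasoning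
    g : (ρ σ : Bool) (E P : Vec Bool N) → ℕ
    g ρ σ E P = bit (accepts true (ρ , σ) R P E (ρ , σ))

-- A state (t , c) consists of the number t of doublings still to come and
-- the content c; weight s R s′ counts the ways to lead s to s′ along R.
State : Set
State = Bool × Content

-- The counter `t′` comes first in the comparison so that for `t′ = false` it computes to `not t`,
-- as in the base case of `accepts`.
agree : State → State → Bool
agree (t , c) (t′ , c′) = (t′ ≡ᵇ t) ∧ same c c′

allowed : State → (r p e : Bool) → Bool
allowed (t , c) r p e = admissible c r p e ∧ (not (doubling c r p) ∨ t)

move : State → (r p e : Bool) → State
move (t , c) r p e = t ∧ not (doubling c r p) , advance c r p e

-- A factor `bit b` defined by matching: forbidden moves compute to 0, so the recurrences along a
-- word hold by computation up to summands `+ 0`.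
guard : Bool → ℕ → ℕ
guard false _ = 0
guard true  k = k

weight : State → List Bool → State → ℕ
weight s []      s′ = bit (agree s s′)
weight s (r ∷ R) s′ = ∑ᵇ λ e → ∑ᵇ λ p → guard (allowed s r p e) (weight (move s r p e) R s′)

accepts-weight : ∀ {n} t c (R : Vec Bool n) c′ →
  ∑ᵛ n (λ E → ∑ᵛ n λ P → bit (accepts t c R P E c′)) ≡ weight (t , c) (Vec.toList R) (false , c′)
accepts-weight t c [] c′ = refl
accepts-weight {suc n} t c (r ∷ R) c′ = ∑ᵇ-cong λ e →
  trans (∑ᵛ-∑ᵇ n λ p E → ∑ᵛ n λ P → bit (accepts t c (r ∷ R) (p ∷ P) (e ∷ E) c′)) (∑ᵇ-cong λ p →
    let t′ , d = move (t , c) r p e in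
    trans (pull (allowed (t , c) r p e) (λ E P → accepts t′ d R P E c′))
          (cong (guard (allowed (t , c) r p e)) (accepts-weight t′ d R c′)))
  where
  pull : ∀ b (g : Vec Bool n → Vec Bool n → Bool) →
    ∑ᵛ n (λ E → ∑ᵛ n λ P → bit (b ∧ g E P)) ≡ guard b (∑ᵛ n λ E → ∑ᵛ n λ P → bit (g E P))
  pull true  g = refl
  pull false g = trans (∑ᵛ-cong n {g = λ _ → 0} λ _ → ∑ᵛ-zero n) (∑ᵛ-zero n)

∑ˢ : (State → ℕ) → ℕ
∑ˢ f = ∑ᵇ λ t → ∑ᵇ λ ρ → ∑ᵇ λ σ → f (t , ρ , σ)

∑ˢ-cong : ∀ {f g} → (∀ s → f s ≡ g s) → ∑ˢ f ≡ ∑ˢ g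
∑ˢ-cong h = ∑ᵇ-cong λ t → ∑ᵇ-cong λ ρ → ∑ᵇ-cong λ σ → h (t , ρ , σ)

∑ᵇ-+ : ∀ f g → ∑ᵇ (λ b → f b + g b) ≡ ∑ᵇ f + ∑ᵇ g
∑ᵇ-+ f g = +-interchange (f false) _ _ _

∑ˢ-+ : ∀ f g → ∑ˢ (λ s → f s + g s) ≡ ∑ˢ f + ∑ˢ g
∑ˢ-+ f g = begin
  (∑ᵇ λ t → ∑ᵇ λ ρ → ∑ᵇ λ σ → f (t , ρ , σ) + g (t , ρ , σ))
    ≡⟨ (∑ᵇ-cong λ t → ∑ᵇ-cong λ ρ → ∑ᵇ-+ (λ σ → f (t , ρ , σ)) (λ σ → g (t , ρ , σ))) ⟩
  (∑ᵇ λ t → ∑ᵇ λ ρ → (∑ᵇ λ σ → f (t , ρ , σ)) + ∑ᵇ λ σ → g (t , ρ , σ))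
    ≡⟨ (∑ᵇ-cong λ t → ∑ᵇ-+ (λ ρ → ∑ᵇ λ σ → f (t , ρ , σ)) (λ ρ → ∑ᵇ λ σ → g (t , ρ , σ))) ⟩
  (∑ᵇ λ t → (∑ᵇ λ ρ → ∑ᵇ λ σ → f (t , ρ , σ)) + ∑ᵇ λ ρ → ∑ᵇ λ σ → g (t , ρ , σ))
    ≡⟨ ∑ᵇ-+ (λ t → ∑ᵇ λ ρ → ∑ᵇ λ σ → f (t , ρ , σ)) (λ t → ∑ᵇ λ ρ → ∑ᵇ λ σ → g (t , ρ , σ)) ⟩
  ∑ˢ f + ∑ˢ g ∎
  where open ≡-Reasoning

∑ˢ-agree : ∀ s (f : State → ℕ) → ∑ˢ (λ s′ → bit (agree s s′) * f s′) ≡ f s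
∑ˢ-agree (false , false , false) f =
  trans (+-identityʳ _) (trans (+-identityʳ _) (trans (+-identityʳ _) (+-identityʳ _)))
∑ˢ-agree (false , false , true) f = trans (+-identityʳ _) (trans (+-identityʳ _) (+-identityʳ _))
∑ˢ-agree (false , true , false) f = trans (+-identityʳ _) (trans (+-identityʳ _) (+-identityʳ _))
∑ˢ-agree (false , true , true) f = trans (+-identityʳ _) (+-identityʳ _)
∑ˢ-agree (true , false , false) f =
  trans (+-identityʳ _) (trans (+-identityʳ _) (+-identityʳ _))
∑ˢ-agree (true , false , true) f = trans (+-identityʳ _) (+-identityʳ _)
∑ˢ-agree (true , true , false) f = trans (+-identityʳ _) (+-identityʳ _)
∑ˢ-agree (true , true , true) f = +-identityʳ _

-- Multiplicativity of the transfer matrices.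
weight-++ : ∀ s R R′ s″ → weight s (R ++ R′) s″ ≡ ∑ˢ λ s′ → weight s R s′ * weight s′ R′ s″
weight-++ s []      R′ s″ = sym (∑ˢ-agree s λ s′ → weight s′ R′ s″)
weight-++ s (r ∷ R) R′ s″ = begin
  (∑ᵇ λ e → ∑ᵇ λ p → guard (allowed s r p e) (weight (move s r p e) (R ++ R′) s″))
    ≡⟨ (∑ᵇ-cong λ e → ∑ᵇ-cong λ p → cong (guard (allowed s r p e)) (weight-++ (move s r p e) R R′ s″)) ⟩
  (∑ᵇ λ e → ∑ᵇ λ p → guard (allowed s r p e) (∑ˢ λ s′ → weight (move s r p e) R s′ * G s′))
    ≡⟨ (∑ᵇ-cong λ e → ∑ᵇ-cong λ p → guard-∑ˢ (allowed s r p e) (weight (move s r p e) R)) ⟩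
  (∑ᵇ λ e → ∑ᵇ λ p → ∑ˢ λ s′ → H e p s′ * G s′)
    ≡⟨ (∑ᵇ-cong λ e → merge (H e)) ⟩
  (∑ᵇ λ e → ∑ˢ λ s′ → (∑ᵇ λ p → H e p s′) * G s′)
    ≡⟨ merge (λ e s′ → ∑ᵇ λ p → H e p s′) ⟩
  (∑ˢ λ s′ → weight s (r ∷ R) s′ * G s′) ∎
  where
  open ≡-Reasoning
  G : State → ℕ
  G s′ = weight s′ R′ s″
  H : (e p : Bool) → State → ℕ
  H e p s′ = guard (allowed s r p e) (weight (move s r p e) R s′)
  guard-∑ˢ : ∀ b (f : State → ℕ) → guard b (∑ˢ λ s′ → f s′ * G s′) ≡ ∑ˢ λ s′ → guard b (f s′) * G s′
  guard-∑ˢ true  f = refl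
  guard-∑ˢ false f = refl
  merge : ∀ (f : Bool → State → ℕ) → (∑ᵇ λ b → ∑ˢ λ s′ → f b s′ * G s′) ≡ ∑ˢ λ s′ → (∑ᵇ λ b → f b s′) * G s′
  merge f = trans (sym (∑ˢ-+ (λ s′ → f false s′ * G s′) (λ s′ → f true s′ * G s′)))
                  (∑ˢ-cong λ s′ → sym (ℕ.*-distribʳ-+ (G s′) (f false s′) (f true s′)))

weight-no-gain : ∀ c R c′ → weight (false , c) R (true , c′) ≡ 0
weight-no-gain c []      c′ = refl
weight-no-gain c (r ∷ R) c′ = cong₂ _+_ (cong₂ _+_ (term false false) (term true false))
                                        (cong₂ _+_ (term false true) (term true true))
  where
  term : ∀ p e → guard (allowed (false , c) r p e) (weight (move (false , c) r p e) R (true , c′)) ≡ 0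
  term p e with allowed (false , c) r p e
  ... | true  = weight-no-gain _ R c′
  ... | false = refl

-- A counter that ends where it started records no doubling, whichever of its two values it has; a
-- run that does double has dropped to `false` and is killed by `weight-no-gain`.
weight-shift : ∀ c R c′ → weight (true , c) R (true , c′) ≡ weight (false , c) R (false , c′)
weight-shift c []      c′ = refl
weight-shift c (r ∷ R) c′ = ∑ᵇ-cong λ e → ∑ᵇ-cong λ p → term p e
  where
  term : ∀ p e → guard (allowed (true , c) r p e) (weight (move (true , c) r p e) R (true , c′)) ≡
                 guard (allowed (false , c) r p e) (weight (move (false , c) r p e) R (false , c′))
  term p e with admissible c r p e | doubling c r p
  ... | false | _     = refl
  ... | true  | false = weight-shift _ R c′
  ... | true  | true  = weight-no-gain _ R c′

∑ᶜ : (Content → ℕ) → ℕ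
∑ᶜ f = ∑ᵇ λ ρ → ∑ᵇ λ σ → f (ρ , σ)

∑ᶜ-cong : ∀ {f g} → (∀ c → f c ≡ g c) → ∑ᶜ f ≡ ∑ᶜ g
∑ᶜ-cong h = ∑ᵇ-cong λ ρ → ∑ᵇ-cong λ σ → h (ρ , σ)

∑ᶜ-+ : ∀ f g → ∑ᶜ (λ c → f c + g c) ≡ ∑ᶜ f + ∑ᶜ g
∑ᶜ-+ f g = trans
  (∑ᵇ-cong λ ρ → ∑ᵇ-+ (λ σ → f (ρ , σ)) (λ σ → g (ρ , σ)))
  (∑ᵇ-+ (λ ρ → ∑ᵇ λ σ → f (ρ , σ)) (λ ρ → ∑ᵇ λ σ → g (ρ , σ)))

∑ᶜ-swap : ∀ (h : Content → Content → ℕ) → (∑ᶜ λ c → ∑ᶜ λ d → h c d) ≡ ∑ᶜ λ d → ∑ᶜ λ c → h c d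
∑ᶜ-swap h = sym (trans
  (∑ᶜ-+ (λ d → ∑ᵇ λ σ → h (false , σ) d) (λ d → ∑ᵇ λ σ → h (true , σ) d))
  (∑ᵇ-cong λ ρ → ∑ᶜ-+ (h (ρ , false)) (h (ρ , true))))

trace : List Bool → ℕ
trace R = ∑ᶜ λ c → weight (true , c) R (false , c)

-- The one doubling happens in `X` (`later`) or in `Y` (`sooner`). In matrix terms the trace of C_X
-- D_Y + D_X C_Y is taken, and exchanging `X` and `Y` exchanges the two summands under the trace,
-- because `weight-shift` identifies the diagonal blocks for both values of the counter.
trace-rotate : ∀ X Y → trace (X ++ Y) ≡ trace (Y ++ X)
trace-rotate X Y = begin
  trace (X ++ Y)
    ≡⟨ (∑ᶜ-cong λ c → weight-++ (true , c) X Y (false , c)) ⟩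
  (∑ᶜ λ c → (∑ᶜ λ d → later X Y c d) + ∑ᶜ λ d → sooner X Y c d)
    ≡⟨ ∑ᶜ-+ (λ c → ∑ᶜ (later X Y c)) (λ c → ∑ᶜ (sooner X Y c)) ⟩
  (∑ᶜ λ c → ∑ᶜ λ d → later X Y c d) + (∑ᶜ λ c → ∑ᶜ λ d → sooner X Y c d)
    ≡⟨ cong₂ _+_ (trans (∑ᶜ-swap (later X Y)) (∑ᶜ-cong λ d → ∑ᶜ-cong λ c → later≡sooner X Y c d))
                 (trans (∑ᶜ-swap (sooner X Y)) (∑ᶜ-cong λ d → ∑ᶜ-cong λ c → sym (later≡sooner Y X d c))) ⟩
  (∑ᶜ λ d → ∑ᶜ λ c → sooner Y X d c) + (∑ᶜ λ d → ∑ᶜ λ c → later Y X d c)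
    ≡⟨ +-comm (∑ᶜ λ d → ∑ᶜ λ c → sooner Y X d c) _ ⟩
  (∑ᶜ λ d → ∑ᶜ λ c → later Y X d c) + (∑ᶜ λ d → ∑ᶜ λ c → sooner Y X d c)
    ≡⟨ ∑ᶜ-+ (λ d → ∑ᶜ (later Y X d)) (λ d → ∑ᶜ (sooner Y X d)) ⟨
  (∑ᶜ λ d → (∑ᶜ λ c → later Y X d c) + ∑ᶜ λ c → sooner Y X d c)
    ≡⟨ (∑ᶜ-cong λ d → weight-++ (true , d) Y X (false , d)) ⟨
  trace (Y ++ X) ∎
  where
  open ≡-Reasoning
  later sooner : List Bool → List Bool → Content → Content → ℕ
  later  X Y c d = weight (true , c) X (false , d) * weight (false , d) Y (false , c)
  sooner X Y c d = weight (true , c) X (true , d) * weight (true , d) Y (false , c)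
  later≡sooner : ∀ X Y c d → later X Y c d ≡ sooner Y X d c
  later≡sooner X Y c d = trans (*-comm (weight (true , c) X (false , d)) _)
    (cong (_* weight (true , c) X (false , d)) (sym (weight-shift d Y c)))

-- even k = F₂ₖ and odd k = F₂ₖ₊₁
even odd : ℕ → ℕ
even zero    = 0
even (suc k) = even k + odd k
odd zero    = 1
odd (suc k) = even (suc k) + odd k

sumEven : ℕ → ℕ
sumEven zero    = 0
sumEven (suc k) = sumEven k + even (suc k)

-- Evaluation of the trace, one root at a time

pattern none  = false , false
pattern spoke = false , true
pattern root  = true , false
pattern both  = true , true

drop-zeros : ∀ x y → (x + 0) + (y + 0) ≡ x + y
drop-zeros = solve-∀

module Block (X : List Bool) (s′ : State) where

  w : State → ℕ → ℕ
  w s k = weight s (replicate k false ++ X) s′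

  -- From `none` an absent edge forces the spoke, while a present edge leaves it optional.
  w-none-suc : ∀ t k → w (t , none) (suc k) ≡ w (t , none) k + (w (t , none) k + w (t , spoke) k)
  w-none-suc false k = refl
  w-none-suc true  k = refl

  w-spoke-suc : ∀ t k → w (t , spoke) (suc k) ≡ w (t , none) k + w (t , spoke) k
  w-spoke-suc false k = drop-zeros (w (false , none) k) (w (false , spoke) k)
  w-spoke-suc true  k = drop-zeros (w (true , none) k) (w (true , spoke) k)

  w-both-suc : ∀ t k → w (t , both) (suc k) ≡ w (t , none) k + w (t , both) k
  w-both-suc false k = drop-zeros (w (false , none) k) (w (false , both) k)
  w-both-suc true  k = drop-zeros (w (true , none) k) (w (true , both) k)

  module _ (t : Bool) where
    private
      x = w (t , none) 0
      y = w (t , spoke) 0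

    -- By `w-none-suc` and `w-spoke-suc` one vertex acts by the matrix with rows (2, 1) and (1, 1),
    -- whose powers consist of Fibonacci numbers. The second component is the value of
    -- `w (t , spoke)` at `suc k`; carrying it along closes the induction.
    w-none : ∀ k → w (t , none) k ≡ odd k * x + even k * y ×
                   w (t , none) k + w (t , spoke) k ≡ even (suc k) * x + odd k * y
    w-none zero    = base₁ x y , base₂ x y
      where
      base₁ : ∀ x y → x ≡ 1 * x + 0 * y
      base₁ = solve-∀
      base₂ : ∀ x y → x + y ≡ 1 * x + 1 * y
      base₂ = solve-∀
    w-none (suc k) with w-none k
    ... | p , q = p′ , trans (cong₂ _+_ p′ (trans (w-spoke-suc t k) q)) (step₂ (even (suc k)) (odd k) x y)
      where
      step₁ : ∀ a b x y → (b * x + a * y) + ((a + b) * x + b * y) ≡ ((a + b) + b) * x + (a + b) * y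
      step₁ = solve-∀
      step₂ : ∀ a b x y → ((a + b) * x + a * y) + (a * x + b * y) ≡ (a + (a + b)) * x + (a + b) * y
      step₂ = solve-∀
      p′ = trans (w-none-suc t k) (trans (cong₂ _+_ p q) (step₁ (even k) (odd k) x y))

    -- An arc that can take no further spoke only has to end somewhere, after which the content is
    -- `none`. So the left side sums `w (t , none)` over all possible ends up to `k`, and the sum of
    -- F₁, F₃, ... , F₂ₖ₊₁ is F₂ₖ₊₂.
    accumulate : ∀ (v : ℕ → ℕ) → v 0 ≡ 0 → (∀ k → v (suc k) ≡ w (t , none) k + v k) →
                 ∀ k → w (t , none) k + v k ≡ even (suc k) * x + sumEven k * y
    accumulate v v0 v-suc zero = trans (cong (x +_) v0) (base x y)
      where
      base : ∀ x y → x + 0 ≡ 1 * x + 0 * y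
      base = solve-∀
    accumulate v v0 v-suc (suc k) = trans
      (cong₂ _+_ (proj₁ (w-none (suc k))) (trans (v-suc k) (accumulate v v0 v-suc k)))
      (step (even (suc k)) (odd k) (sumEven k) x y)
      where
      step : ∀ a b c x y → ((a + b) * x + a * y) + (a * x + c * y) ≡ (a + (a + b)) * x + (c + a) * y
      step = solve-∀

  -- An arc with a root cannot run on into `X`: there it would meet the next root, or the final
  -- content, which has none.
  module _ (root-zero : ∀ t → w (t , root) 0 ≡ 0) (both-zero : ∀ t → w (t , both) 0 ≡ 0) where

    w-both : ∀ t k → w (t , none) k + w (t , both) k ≡
             even (suc k) * w (t , none) 0 + sumEven k * w (t , spoke) 0
    w-both t = accumulate t (w (t , both)) (both-zero t) (w-both-suc t)

    w-root : ∀ k → w (false , none) k + w (false , root) k ≡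
             even (suc k) * w (false , none) 0 + sumEven k * w (false , spoke) 0
    w-root = accumulate false (w (false , root)) (root-zero false)
      λ k → drop-zeros (w (false , none) k) (w (false , root) k)

    block-false : ∀ k → weight (false , none) (true ∷ replicate k false ++ X) s′ ≡
                  even (suc k) * w (false , none) 0 + sumEven k * w (false , spoke) 0
    block-false k = trans (drop-zeros (w (false , none) k) (w (false , root) k)) (w-root k)

    block-spoke : ∀ k → weight (true , spoke) (true ∷ replicate k false ++ X) s′ ≡
                  even (suc k) * w (false , none) 0 + sumEven k * w (false , spoke) 0
    block-spoke k = trans (drop-zeros (w (false , none) k) (w (false , both) k)) (w-both false k)

    -- The last summand counts the runs whose doubling happens within this block. The hypothesis
    -- holds since a spoke carried to the next root would cause a doubling when none is left.
    block-true : w (false , spoke) 0 ≡ 0 → ∀ k →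
      weight (true , none) (true ∷ replicate k false ++ X) s′ ≡
      (even (suc k) * w (true , none) 0 + sumEven k * w (true , spoke) 0) + sumEven (suc k) * w (false , none) 0
    block-true y₀ zero = trans
      (cong₂ (λ a b → (x₁ + x₀) + (a + b)) (root-zero true) (both-zero false)) (base x₀ x₁ (w (true , spoke) 0))
      where
      x₀ = w (false , none) 0
      x₁ = w (true , none) 0
      base : ∀ x₀ x₁ y₁ → (x₁ + x₀) + (0 + 0) ≡ (1 * x₁ + 0 * y₁) + 1 * x₀
      base = solve-∀
    block-true y₀ (suc k) = begin
      (w (true , none) (suc k) + w (false , none) (suc k)) + (w (true , root) (suc k) + w (false , both) (suc k))
        ≡⟨ shuffle (w (true , none) (suc k)) (w (false , none) (suc k)) (w (true , root) (suc k)) _ ⟩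
      w (true , none) (suc k) + (w (false , none) (suc k) + w (false , both) (suc k)) + w (true , root) (suc k)
        -- Content `root` at a non-root and content `none` at a root admit the same moves, so
        -- `w (true , root) (suc k)` computes to the left side for `k`, and `block-true y₀ k` is the
        -- induction hypothesis.
        ≡⟨ cong₂ _+_ (cong₂ _+_ (proj₁ (w-none true (suc k))) (w-both false (suc k))) (block-true y₀ k) ⟩
      odd (suc k) * x₁ + even (suc k) * y₁ + (even (suc (suc k)) * x₀ + sumEven (suc k) * w (false , spoke) 0)
        + ((even (suc k) * x₁ + sumEven k * y₁) + sumEven (suc k) * x₀)
        ≡⟨ cong (λ y → odd (suc k) * x₁ + even (suc k) * y₁ + (even (suc (suc k)) * x₀ + sumEven (suc k) * y)
                  + ((even (suc k) * x₁ + sumEven k * y₁) + sumEven (suc k) * x₀)) y₀ ⟩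
      odd (suc k) * x₁ + even (suc k) * y₁ + (even (suc (suc k)) * x₀ + sumEven (suc k) * 0)
        + ((even (suc k) * x₁ + sumEven k * y₁) + sumEven (suc k) * x₀)
        ≡⟨ collect (even (suc k)) (odd (suc k)) (sumEven k) x₀ x₁ y₁ ⟩
      (even (suc (suc k)) * x₁ + sumEven (suc k) * y₁) + sumEven (suc (suc k)) * x₀ ∎
      where
      open ≡-Reasoning
      x₀ = w (false , none) 0
      x₁ = w (true , none) 0
      y₁ = w (true , spoke) 0
      shuffle : ∀ a b c d → (a + b) + (c + d) ≡ a + (b + d) + c
      shuffle = solve-∀
      collect : ∀ a b c x₀ x₁ y₁ →
        b * x₁ + a * y₁ + ((a + b) * x₀ + (c + a) * 0) + ((a * x₁ + c * y₁) + (c + a) * x₀) ≡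
        ((a + b) * x₁ + (c + a) * y₁) + ((c + a) + (a + b)) * x₀
      collect = solve-∀

-- The word of a rim read from a root on; k counts the vertices that
-- separate a root from the next one, so the cyclic intervals are suc k.
word : List ℕ → List Bool
word []       = []
word (k ∷ ks) = true ∷ replicate k false ++ word ks

φ γ : ℕ → ℕ
φ k = even (suc k)
γ k = sumEven k + sumEven (suc k)

∏φ : List ℕ → ℕ
∏φ []       = 1
∏φ (k ∷ ks) = φ k * ∏φ ks

-- The product rule: `Z ks` is the ε-coefficient of the product of all `φ k + ε γ k`.
Z : List ℕ → ℕ
Z []       = 0
Z (k ∷ ks) = γ k * ∏φ ks + φ k * Z ks

module _ where
  private
    word-root : ∀ ks t σ σ′ → weight (t , true , σ) (word ks) (false , false , σ′) ≡ 0
    word-root []       false _     _ = refl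
    word-root []       true  _     _ = refl
    word-root (k ∷ ks) false false _ = refl
    word-root (k ∷ ks) false true  _ = refl
    word-root (k ∷ ks) true  false _ = refl
    word-root (k ∷ ks) true  true  _ = refl

    module B (ks : List ℕ) (σ′ : Bool) where
      open Block (word ks) (false , false , σ′) public
      rz = λ t → word-root ks t false σ′
      bz = λ t → word-root ks t true σ′

    spoke-zero : ∀ ks → weight (false , spoke) (word ks) (false , none) ≡ 0
    spoke-zero []       = refl
    spoke-zero (k ∷ ks) = refl

    none-none : ∀ ks → weight (false , none) (word ks) (false , none) ≡ ∏φ ks
    none-none []       = refl
    none-none (k ∷ ks) = trans (block-false rz bz k)
      (trans (cong₂ (λ a b → φ k * a + sumEven k * b) (none-none ks) (spoke-zero ks))
             (simplify (φ k * ∏φ ks) (sumEven k)))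
      where
      open B ks false
      simplify : ∀ a c → a + c * 0 ≡ a
      simplify = solve-∀

    spoke-none : ∀ k ks → weight (true , spoke) (word (k ∷ ks)) (false , none) ≡ ∏φ (k ∷ ks)
    spoke-none k ks = trans (block-spoke rz bz k) (trans (sym (block-false rz bz k)) (none-none (k ∷ ks)))
      where open B ks false

    spoke-spoke : ∀ k ks → weight (true , spoke) (word (k ∷ ks)) (false , spoke) ≡
                  weight (false , none) (word (k ∷ ks)) (false , spoke)
    spoke-spoke k ks = trans (block-spoke rz bz k) (sym (block-false rz bz k))
      where open B ks true

    -- The spoke of the double arc lies in the interval of the first root, in `γ k` ways, or in a
    -- later one. The two parts of `γ k` correspond to the root of that arc: the one at or to the
    -- left of the spoke (`sumEven (suc k)`), or the next one (`sumEven k`), where the block ends in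
    -- `spoke` and the doubling comes later. For the last block the next root is the first one,
    -- which is what the second summand accounts for.
    diagonal : ∀ k ks → weight (true , none) (word (k ∷ ks)) (false , none)
                      + weight (false , none) (word (k ∷ ks)) (false , spoke) ≡ Z (k ∷ ks)
    diagonal k [] = trans
      (cong₂ _+_ (B.block-true [] false (B.rz [] false) (B.bz [] false) refl k)
                 (B.block-false [] true (B.rz [] true) (B.bz [] true) k))
      (simplify (φ k) (sumEven k) (sumEven (suc k)))
      where
      simplify : ∀ a b c → ((a * 0 + b * 0) + c * 1) + (a * 0 + b * 1) ≡ (b + c) * 1 + a * 0
      simplify = solve-∀
    diagonal k ks@(k′ ∷ ks′) = begin
      weight (true , none) (word (k ∷ ks)) (false , none) + weight (false , none) (word (k ∷ ks)) (false , spoke)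
        ≡⟨ cong₂ _+_ (B.block-true ks false (B.rz ks false) (B.bz ks false) (spoke-zero ks) k)
                     (B.block-false ks true (B.rz ks true) (B.bz ks true) k) ⟩
      ((φ k * a + sumEven k * weight (true , spoke) (word ks) (false , none))
        + sumEven (suc k) * weight (false , none) (word ks) (false , none)) + (φ k * b + sumEven k * 0)
        ≡⟨ cong₂ (λ c d → ((φ k * a + sumEven k * c) + sumEven (suc k) * d) + (φ k * b + sumEven k * 0))
                 (spoke-none k′ ks′) (none-none ks) ⟩
      ((φ k * a + sumEven k * ∏φ ks) + sumEven (suc k) * ∏φ ks) + (φ k * b + sumEven k * 0)
        ≡⟨ regroup (φ k) a (sumEven k) (sumEven (suc k)) (∏φ ks) b ⟩
      γ k * ∏φ ks + φ k * (a + b)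
        ≡⟨ cong (λ z → γ k * ∏φ ks + φ k * z) (diagonal k′ ks′) ⟩
      Z (k ∷ ks) ∎
      where
      open ≡-Reasoning
      a = weight (true , none) (word ks) (false , none)
      b = weight (false , none) (word ks) (false , spoke)
      regroup : ∀ f a c d p b → ((f * a + c * p) + d * p) + (f * b + c * 0) ≡ (c + d) * p + f * (a + b)
      regroup = solve-∀

  -- The word begins with a root, so the contents `root` and `both` contribute 0 by computation.
  trace-word : ∀ k ks → trace (word (k ∷ ks)) ≡ Z (k ∷ ks)
  trace-word k ks = trans (+-identityʳ _)
    (trans (cong (weight (true , none) (word (k ∷ ks)) (false , none) +_) (spoke-spoke k ks)) (diagonal k ks))

-- Cyclic intervals

positions : ℕ → List Bool → List ℕ
positions o []          = []
positions o (true ∷ R)  = o ∷ positions (suc o) R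
positions o (false ∷ R) = positions (suc o) R

does-∈? : ∀ {n} (i : Fin n) (R : Subset n) → Dec.does (i ∈? R) ≡ Vec.lookup R i
does-∈? zero    (false ∷ R) = refl
does-∈? zero    (true ∷ R)  = refl
does-∈? (suc i) (_ ∷ R)     = does-∈? i R

labels-positions : ∀ {n} (R : Subset n) → labels R ≡ positions 1 (Vec.toList R)
labels-positions R = go R 1 id (λ i → does-∈? i R) (λ i → refl)
  where
  go : ∀ {m} (Q : Subset m) o (g : Fin m → Fin _) → (∀ i → Dec.does (g i ∈? R) ≡ Vec.lookup Q i) →
       (∀ i → suc (toℕ (g i)) ≡ o + toℕ i) →
       map (suc ∘ toℕ) (filter (_∈? R) (tabulate g)) ≡ positions o (Vec.toList Q)
  go []      o g h p = refl
  go (b ∷ Q) o g h p with Dec.does (g zero ∈? R) | h zero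
  ... | false | refl = go Q (suc o) (g ∘ suc) (h ∘ suc) λ i → trans (p (suc i)) (+-suc o (toℕ i))
  ... | true  | refl = cong₂ _∷_ (trans (p zero) (+-identityʳ o))
    (go Q (suc o) (g ∘ suc) (h ∘ suc) λ i → trans (p (suc i)) (+-suc o (toℕ i)))

-- The length of the initial run of non-roots, and the number of non-roots
-- that follow each root.
runs : List Bool → ℕ × List ℕ
runs []          = 0 , []
runs (true ∷ R)  = let a , ks = runs R in 0 , a ∷ ks
runs (false ∷ R) = let a , ks = runs R in suc a , ks

runs-word : ∀ R → let a , ks = runs R in R ≡ replicate a false ++ word ks
runs-word []          = refl
runs-word (true ∷ R)  = cong (true ∷_) (runs-word R)
runs-word (false ∷ R) = cong (false ∷_) (runs-word R)

runs-replicate : ∀ a ks → runs (replicate a false ++ word ks) ≡ (a , ks)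
runs-replicate (suc a) ks rewrite runs-replicate a ks = refl
runs-replicate zero []       = refl
runs-replicate zero (k ∷ ks) rewrite runs-replicate k ks = refl

wrapRun : ℕ → List ℕ → List ℕ
wrapRun a []            = []
wrapRun a (k ∷ [])      = [ k + a ]
wrapRun a (k ∷ k′ ∷ ks) = k ∷ wrapRun a (k′ ∷ ks)

separations : List Bool → List ℕ
separations R = uncurry wrapRun (runs R)

total : List ℕ → ℕ
total = sum ∘ map suc

positions-replicate : ∀ o k R → positions o (replicate k false ++ R) ≡ positions (k + o) R
positions-replicate o zero    R = refl
positions-replicate o (suc k) R = trans (positions-replicate (suc o) k R) (cong (λ z → positions z R) (+-suc k o))

-- The closing label `e` lies `a` beyond the end of the word, because the `a` non-roots before the
-- first root belong to the interval of the last one.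
gaps-positions : ∀ o e a ks → e ≡ o + (total ks + a) →
  gaps e (positions o (word ks)) ≡ map suc (wrapRun a ks)
gaps-positions o e a []       eq = refl
gaps-positions o e a (k ∷ ks) eq rewrite positions-replicate (suc o) k (word ks) = go ks eq
  where
  go : ∀ ks → e ≡ o + (total (k ∷ ks) + a) →
       gaps e (o ∷ positions (k + suc o) (word ks)) ≡ map suc (wrapRun a (k ∷ ks))
  go [] eq = cong [_] (trans (cong (_∸ o) eq) (trans (ℕ.m+n∸m≡n o _) (cong (λ z → suc z + a) (+-identityʳ k))))
  go (k′ ∷ ks) eq = cong₂ _∷_
    (trans (cong (_∸ o) (+-suc k o)) (ℕ.m+n∸n≡m (suc k) o))
    (gaps-positions (k + suc o) e a (k′ ∷ ks) (trans eq (shuffle o k (total (k′ ∷ ks)) a)))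
    where
    shuffle : ∀ o k t a → o + (suc k + t + a) ≡ k + suc o + (t + a)
    shuffle = solve-∀

length-runs : ∀ R → let a , ks = runs R in length R ≡ total ks + a
length-runs []          = refl
length-runs (true ∷ R)  = cong suc (trans (length-runs R) (shuffle (total (proj₂ (runs R))) _))
  where
  shuffle : ∀ t a → t + a ≡ a + t + 0
  shuffle = solve-∀
length-runs (false ∷ R) = trans (cong suc (length-runs R)) (sym (+-suc (total (proj₂ (runs R))) _))

cyclicIntervals-separations : ∀ {N} (R : Subset N) → cyclicIntervals R ≡ map suc (separations (Vec.toList R))
cyclicIntervals-separations {N} R = begin
  closeUp N (labels R)
    ≡⟨ cong (closeUp N) (labels-positions R) ⟩
  closeUp N (positions 1 Q)
    ≡⟨ cong₂ (λ n X → closeUp n (positions 1 X)) (sym (length-toList R)) (runs-word Q) ⟩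
  closeUp (length Q) (positions 1 (replicate a false ++ word ks))
    ≡⟨ cong₂ closeUp (length-runs Q) (positions-replicate 1 a (word ks)) ⟩
  closeUp (total ks + a) (positions (a + 1) (word ks)) ≡⟨ close ks ⟩
  map suc (wrapRun a ks) ∎
  where
  open ≡-Reasoning
  Q = Vec.toList R
  a = proj₁ (runs Q)
  ks = proj₂ (runs Q)
  close : ∀ ks → closeUp (total ks + a) (positions (a + 1) (word ks)) ≡ map suc (wrapRun a ks)
  close []       = refl
  close (k ∷ ks) = gaps-positions (a + 1) _ a (k ∷ ks) refl

length-wrapRun : ∀ a ks → length (wrapRun a ks) ≡ length ks
length-wrapRun a []            = refl
length-wrapRun a (k ∷ [])      = refl
length-wrapRun a (k ∷ k′ ∷ ks) = cong suc (length-wrapRun a (k′ ∷ ks))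

total-wrapRun : ∀ a k ks → total (wrapRun a (k ∷ ks)) ≡ total (k ∷ ks) + a
total-wrapRun a k []        = cong suc (shuffle k a)
  where
  shuffle : ∀ k a → k + a + 0 ≡ k + 0 + a
  shuffle = solve-∀
total-wrapRun a k (k′ ∷ ks) = trans (cong (suc k +_) (total-wrapRun a k′ ks)) (sym (+-assoc (suc k) _ a))

size-runs : ∀ {N} (R : Subset N) → ∣ R ∣ ≡ length (proj₂ (runs (Vec.toList R)))
size-runs []          = refl
size-runs (false ∷ R) = size-runs R
size-runs (true ∷ R)  = cong suc (size-runs R)

record Separations (N r : ℕ) (ks : List ℕ) : Set where
  field
    count : length ks ≡ r
    fill  : total ks ≡ N

separations-valid : ∀ {N r} → 1 ≤ r → (R : Subset N) → ∣ R ∣ ≡ r → Separations N r (separations (Vec.toList R))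
separations-valid {N} {r} r≥1 R size with runs (Vec.toList R) | size-runs R | length-runs (Vec.toList R)
... | a , []     | s | _ = contradiction r≥1 (ℕ.<⇒≱ (ℕ.≤-reflexive (cong suc (trans (sym size) s))))
... | a , k ∷ ks | s | l = record
  { count = trans (length-wrapRun a (k ∷ ks)) (trans (sym s) size)
  ; fill  = trans (total-wrapRun a k ks) (trans (sym l) (length-toList R)) }

length-word : ∀ ks → length (word ks) ≡ total ks
length-word []       = refl
length-word (k ∷ ks) = cong suc (trans (length-++ (replicate k false))
                         (cong₂ _+_ (length-replicate k) (length-word ks)))

separations-surjective : ∀ {N r ks} → Separations N r ks →
  ∃ λ (R : Subset N) → ∣ R ∣ ≡ r × separations (Vec.toList R) ≡ ks
separations-surjective {ks = ks} record { count = refl ; fill = refl } =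
  subst (λ N → ∃ λ (R : Subset N) → ∣ R ∣ ≡ length ks × separations (Vec.toList R) ≡ ks) (length-word ks)
    ( Vec.fromList (word ks)
    , trans (size-runs (Vec.fromList (word ks))) (cong (length ∘ proj₂) runs≡)
    , trans (cong (uncurry wrapRun) runs≡) (wrapRun-0 ks))
  where
  runs≡ : runs (Vec.toList (Vec.fromList (word ks))) ≡ (0 , ks)
  runs≡ = trans (cong runs (toList∘fromList (word ks))) (runs-replicate 0 ks)
  wrapRun-0 : ∀ ks → wrapRun 0 ks ≡ ks
  wrapRun-0 []            = refl
  wrapRun-0 (k ∷ [])      = cong [_] (+-identityʳ k)
  wrapRun-0 (k ∷ k′ ∷ ks) = cong (k ∷_) (wrapRun-0 (k′ ∷ ks))

word-wrapRun : ∀ a k ks → word (k ∷ ks) ++ replicate a false ≡ word (wrapRun a (k ∷ ks))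
word-wrapRun a k ks = trans (cong (true ∷_) (++-assoc (replicate k false) (word ks) _)) (go ks)
  where
  go : ∀ ks → true ∷ replicate k false ++ word ks ++ replicate a false ≡ word (wrapRun a (k ∷ ks))
  go []        = cong (true ∷_) (sym (trans (++-identityʳ _) (replicate-+ k)))
    where
    replicate-+ : ∀ k → replicate (k + a) false ≡ replicate k false ++ replicate a false
    replicate-+ zero    = refl
    replicate-+ (suc k) = cong (false ∷_) (replicate-+ k)
  go (k′ ∷ ks) = cong (λ X → true ∷ replicate k false ++ X) (word-wrapRun a k′ ks)

ℱ-wheel-separations : ∀ {N r} (N≥3 : 3 ≤ N) → 1 ≤ r → (R : Subset N) → ∣ R ∣ ≡ r →
  ℱ-wheel N N≥3 R ≡ Z (separations (Vec.toList R))
ℱ-wheel-separations {N} {r} N≥3 r≥1 R size = trans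
  (trans (ℱ-wheel-accepts N N≥3 R nonempty) (∑ᶜ-cong λ { c → accepts-weight true c R c }))
  evaluate
  where
  nonempty : ∃ λ u → Vec.lookup R u ≡ true
  nonempty = go R (subst (1 ≤_) (sym size) r≥1)
    where
    go : ∀ {n} (R : Subset n) → 1 ≤ ∣ R ∣ → ∃ λ u → Vec.lookup R u ≡ true
    go (true ∷ R)  _ = zero , refl
    go (false ∷ R) h = let u , eq = go R h in suc u , eq
  evaluate : trace (Vec.toList R) ≡ Z (separations (Vec.toList R))
  evaluate with runs (Vec.toList R) | runs-word (Vec.toList R) | size-runs R
  ... | a , []     | _  | s = contradiction r≥1 (ℕ.<⇒≱ (ℕ.≤-reflexive (cong suc (trans (sym size) s))))
  -- Rotation moves the initial run of `a` non-roots to the end, where it prolongs the last run.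
  ... | a , k ∷ ks | eq | _ = trans (cong trace eq) (trans (trace-rotate (replicate a false) (word (k ∷ ks)))
    (trans (cong trace (word-wrapRun a k ks)) (evaluate-word ks)))
    where
    evaluate-word : ∀ ks → trace (word (wrapRun a (k ∷ ks))) ≡ Z (wrapRun a (k ∷ ks))
    evaluate-word []        = trace-word (k + a) []
    evaluate-word (k′ ∷ ks) = trace-word k (wrapRun a (k′ ∷ ks))

-- Smoothing

-- d'Ocagne's identity, with both sides moved so that no subtraction occurs.
docagne : ∀ n m → even (n + m) * odd n ≡ odd (n + m) * even n + even m
docagne zero    m = base (even m) (odd m)
  where
  base : ∀ a b → a * 1 ≡ b * 0 + a
  base = solve-∀
docagne (suc n) m = ℕ.+-cancelʳ-≡ (even (n + m) * odd n) _ _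
  (trans (cong ((U + V) * (u + v + v) +_) (docagne n m)) (step U V u v (even m)))
  where
  U = even (n + m)
  V = odd (n + m)
  u = even n
  v = odd n
  step : ∀ U V u v d → (U + V) * (u + v + v) + (V * u + d) ≡ (U + V + V) * (u + v) + d + U * v
  step = solve-∀

even-positive : ∀ k → 1 ≤ even (suc k)
even-positive zero    = s≤s z≤n
even-positive (suc k) = ≤-trans (even-positive k) (ℕ.m≤m+n _ _)

∏φ-positive : ∀ ks → 1 ≤ ∏φ ks
∏φ-positive []       = s≤s z≤n
∏φ-positive (k ∷ ks) = ℕ.*-mono-≤ (even-positive k) (∏φ-positive ks)

odd-mono-< : ∀ k m → odd k < odd (suc (k + m))
odd-mono-< k zero    rewrite +-identityʳ k = ℕ.+-monoˡ-≤ (odd k) (even-positive k)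
odd-mono-< k (suc m) rewrite +-suc k m     = <-trans (odd-mono-< k m) (ℕ.+-monoˡ-≤ _ (even-positive (suc (k + m))))

sumEven-odd : ∀ k → suc (sumEven k) ≡ odd k
sumEven-odd zero    = refl
sumEven-odd (suc k) = trans (cong (_+ even (suc k)) (sumEven-odd k)) (+-comm (odd k) _)

-- γ k + 2 is the Lucas number L₂₍ₖ₊₁₎.
γ-lucas : ∀ k → γ k + 2 ≡ odd k + odd (suc k)
γ-lucas k = trans (shuffle (sumEven k) (sumEven (suc k))) (cong₂ _+_ (sumEven-odd k) (sumEven-odd (suc k)))
  where
  shuffle : ∀ a b → a + b + 2 ≡ suc a + suc b
  shuffle = solve-∀

-- The two sides differ by exactly `φ m`: this is `docagne` at `suc b` and `suc m`, with `U * u`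
-- added to both sides.
φφ-smooth : ∀ b m → φ (suc (suc (b + m))) * φ b < φ (suc (b + m)) * φ (suc b)
φφ-smooth b m = ≤-trans (ℕ.+-monoˡ-≤ (φ (suc (suc (b + m))) * φ b) (even-positive m)) (ℕ.≤-reflexive identity)
  where
  U = even (suc (suc (b + m)))
  V = odd (suc (suc (b + m)))
  u = even (suc b)
  v = odd (suc b)
  step : ∀ U V u v d → U * v ≡ V * u + d → d + (U + V) * u ≡ U * (u + v)
  step U V u v d eq = trans (shuffle U V u d) (trans (cong (U * u +_) (sym eq)) (sym (ℕ.*-distribˡ-+ U u v)))
    where
    shuffle : ∀ U V u d → d + (U + V) * u ≡ U * u + (V * u + d)
    shuffle = solve-∀
  identity : φ m + φ (suc (suc (b + m))) * φ b ≡ φ (suc (b + m)) * φ (suc b)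
  identity = step U V u v (φ m)
    (subst (λ n → even n * v ≡ odd n * u + φ m) (cong suc (+-suc b m)) (docagne (suc b) (suc m)))

-- L₂ₐF₂ᵦ + F₂ₐL₂ᵦ = 2F₂₍ₐ₊ᵦ₎ is unaffected by smoothing, so only the
-- contribution of the summand −2 in γ changes.
cross-smooth : ∀ b m → let a = suc (b + m) in
  γ (suc a) * φ b + φ (suc a) * γ b < γ a * φ (suc b) + φ a * γ (suc b)
cross-smooth b m = ℕ.+-cancelʳ-< (2 * (φ (suc b) + φ a)) _ _ (begin-strict
  γ (suc a) * φ b + φ (suc a) * γ b + 2 * (φ (suc b) + φ a)
    <⟨ ℕ.+-monoʳ-< (γ (suc a) * φ b + φ (suc a) * γ b) (ℕ.*-monoʳ-< 2 spread) ⟩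
  γ (suc a) * φ b + φ (suc a) * γ b + 2 * (φ b + φ (suc a))
    ≡⟨ to-lucas (γ (suc a)) (φ (suc a)) (γ b) (φ b) ⟩
  (γ (suc a) + 2) * φ b + φ (suc a) * (γ b + 2)
    ≡⟨ cong₂ (λ x y → x * φ b + φ (suc a) * y) (γ-lucas (suc a)) (γ-lucas b) ⟩
  (odd (suc a) + odd (suc (suc a))) * φ b + φ (suc a) * (odd b + odd (suc b))
    ≡⟨ invariant (even (suc a)) (odd a) (even (suc b)) (odd b) ⟩
  (odd a + odd (suc a)) * φ (suc b) + φ a * (odd (suc b) + odd (suc (suc b)))
    ≡⟨ cong₂ (λ x y → x * φ (suc b) + φ a * y) (γ-lucas a) (γ-lucas (suc b)) ⟨
  (γ a + 2) * φ (suc b) + φ a * (γ (suc b) + 2)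
    ≡⟨ to-lucas (γ a) (φ a) (γ (suc b)) (φ (suc b)) ⟨
  γ a * φ (suc b) + φ a * γ (suc b) + 2 * (φ (suc b) + φ a) ∎)
  where
  open ℕ.≤-Reasoning
  a = suc (b + m)
  to-lucas : ∀ g f g′ f′ → g * f′ + f * g′ + 2 * (f′ + f) ≡ (g + 2) * f′ + f * (g′ + 2)
  to-lucas = solve-∀
  invariant : ∀ q p q′ p′ →
    ((q + p) + ((q + (q + p)) + (q + p))) * q′ + (q + (q + p)) * (p′ + (q′ + p′)) ≡
    (p + (q + p)) * (q′ + (q′ + p′)) + q * ((q′ + p′) + ((q′ + (q′ + p′)) + (q′ + p′)))
  invariant = solve-∀
  spread : φ (suc b) + φ a < φ b + φ (suc a)
  spread = begin-strict
    (φ b + odd (suc b)) + φ a <⟨ ℕ.+-monoˡ-< (φ a) (ℕ.+-monoʳ-< (φ b) (odd-mono-< (suc b) m)) ⟩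
    (φ b + odd (suc a)) + φ a ≡⟨ shuffle (φ b) (odd (suc a)) (φ a) ⟩
    φ b + (φ a + odd (suc a)) ∎
    where
    shuffle : ∀ x y z → (x + y) + z ≡ x + (z + y)
    shuffle = solve-∀

-- `Z` is linear in `∏φ ks` and `Z ks`. Strictness has to come from the first coefficient, since
-- `∏φ ks` is positive whereas `Z ks` vanishes for `ks = []`.
Z-smooth : ∀ {a b} ks → b < a → Z (suc a ∷ b ∷ ks) < Z (a ∷ suc b ∷ ks)
Z-smooth {a} {b} ks b<a with ℕ.m≤n⇒∃[o]m+o≡n b<a
... | m , refl = begin-strict
  Z (suc a ∷ b ∷ ks)
    ≡⟨ expand (γ (suc a)) (φ (suc a)) (γ b) (φ b) (∏φ ks) (Z ks) ⟩
  (γ (suc a) * φ b + φ (suc a) * γ b) * ∏φ ks + φ (suc a) * φ b * Z ks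
    <⟨ ℕ.+-mono-<-≤ (ℕ.*-monoˡ-< (∏φ ks) {{ℕ.>-nonZero (∏φ-positive ks)}} (cross-smooth b m))
                    (ℕ.*-monoˡ-≤ (Z ks) (ℕ.<⇒≤ (φφ-smooth b m))) ⟩
  (γ a * φ (suc b) + φ a * γ (suc b)) * ∏φ ks + φ a * φ (suc b) * Z ks
    ≡⟨ expand (γ a) (φ a) (γ (suc b)) (φ (suc b)) (∏φ ks) (Z ks) ⟨
  Z (a ∷ suc b ∷ ks) ∎
  where
  open ℕ.≤-Reasoning
  expand : ∀ g f g′ f′ p z → g * (f′ * p) + f * (g′ * p + f′ * z) ≡ (g * f′ + f * g′) * p + f * f′ * z
  expand = solve-∀

∏φ-↭ : ∀ {ks ls} → ks ↭ ls → ∏φ ks ≡ ∏φ ls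
∏φ-↭ Perm.refl          = refl
∏φ-↭ (Perm.prep k p)    = cong (φ k *_) (∏φ-↭ p)
∏φ-↭ (Perm.swap k l p)  = trans (shuffle (φ k) (φ l) _) (cong (λ x → φ l * (φ k * x)) (∏φ-↭ p))
  where
  shuffle : ∀ x y z → x * (y * z) ≡ y * (x * z)
  shuffle = solve-∀
∏φ-↭ (Perm.trans p q)   = trans (∏φ-↭ p) (∏φ-↭ q)

Z-↭ : ∀ {ks ls} → ks ↭ ls → Z ks ≡ Z ls
Z-↭ Perm.refl          = refl
Z-↭ (Perm.prep k p)    = cong₂ (λ x y → γ k * x + φ k * y) (∏φ-↭ p) (Z-↭ p)
Z-↭ (Perm.swap {xs = ks} k l p)  = trans (shuffle (γ k) (φ k) (γ l) (φ l) (∏φ ks) (Z ks))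
  (cong₂ (λ x y → γ l * (φ k * x) + φ l * (γ k * x + φ k * y)) (∏φ-↭ p) (Z-↭ p))
  where
  shuffle : ∀ g f g′ f′ p z → g * (f′ * p) + f * (g′ * p + f′ * z) ≡ g′ * (f * p) + f′ * (g * p + f * z)
  shuffle = solve-∀
Z-↭ (Perm.trans p q)   = trans (Z-↭ p) (Z-↭ q)

total-↭ : ∀ {ks ls} → ks ↭ ls → total ks ≡ total ls
total-↭ p = sum-↭ (map⁺ suc p)

separations-↭ : ∀ {N r ks ls} → ks ↭ ls → Separations N r ks → Separations N r ls
separations-↭ p v = record
  { count = trans (sym (↭-length p)) (Separations.count v)
  ; fill  = trans (sym (total-↭ p)) (Separations.fill v) }

separations-smooth : ∀ {N r a b ks} → Separations N r (suc a ∷ b ∷ ks) → Separations N r (a ∷ suc b ∷ ks)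
separations-smooth {a = a} {b} {ks} v = record
  { count = Separations.count v
  ; fill  = trans (shuffle a b (total ks)) (Separations.fill v) }
  where
  shuffle : ∀ a b t → suc a + (suc (suc b) + t) ≡ suc (suc a) + (suc b + t)
  shuffle = solve-∀

separations-rough : ∀ {N r a b ks} → Separations N r (a ∷ suc b ∷ ks) → Separations N r (suc a ∷ b ∷ ks)
separations-rough {a = a} {b} {ks} v = record
  { count = Separations.count v
  ; fill  = trans (shuffle a b (total ks)) (Separations.fill v) }
  where
  shuffle : ∀ a b t → suc (suc a) + (suc b + t) ≡ suc a + (suc (suc b) + t)
  shuffle = solve-∀

all-or-extract : ∀ {P : ℕ → Set} → (∀ x → Dec (P x)) → ∀ xs →
  All P xs ⊎ ∃ λ x → ∃ λ ys → ¬ P x × xs ↭ x ∷ ys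
all-or-extract P? []       = inj₁ []
all-or-extract P? (x ∷ xs) with P? x | all-or-extract P? xs
... | no ¬p | _ = inj₂ (x , xs , ¬p , ↭-refl)
... | yes p | inj₁ ps = inj₁ (p ∷ ps)
... | yes p | inj₂ (y , ys , ¬p , q) = inj₂ (y , x ∷ ys , ¬p , ↭-trans (↭-prep x q) (↭-swap x y ↭-refl))

extract-minimum : ∀ x xs → ∃ λ m → ∃ λ ys → x ∷ xs ↭ m ∷ ys × All (m ≤_) ys
extract-minimum x []       = x , [] , ↭-refl , []
extract-minimum x (y ∷ xs) with extract-minimum y xs
... | m , ys , p , m≤ with ℕ.≤-total x m
...   | inj₁ x≤m = x , m ∷ ys , ↭-prep x p , x≤m ∷ All.map (≤-trans x≤m) m≤
...   | inj₂ m≤x = m , x ∷ ys , ↭-trans (↭-prep x p) (↭-swap x m ↭-refl) , m≤x ∷ m≤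

-- Extremal sequences of intervals

Balanced : List ℕ → Set
Balanced ks = ∃ λ m → ∃ λ ls → ks ↭ m ∷ ls × All (λ x → m ≡ x ⊎ suc m ≡ x) ls

-- It suffices to compare with the smallest entry `m`: an entry above `m + 1` can be smoothed
-- against it, and otherwise every entry is `m` or `m + 1`.
balanced-or-improvable : ∀ {N r} → 1 ≤ r → ∀ ks → Separations N r ks →
  Balanced ks ⊎ ∃ λ ls → Separations N r ls × Z ks < Z ls
balanced-or-improvable r≥1 []       v =
  contradiction r≥1 (ℕ.<⇒≱ (ℕ.≤-reflexive (cong suc (sym (Separations.count v)))))
balanced-or-improvable r≥1 (k ∷ ks) v with extract-minimum k ks
... | m , ls , p , m≤ with all-or-extract (λ x → x ℕ.≤? suc m) ls
...   | inj₁ ≤m = inj₁ (m , ls , p , All.zipWith (uncurry close) (m≤ , ≤m))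
  where
  close : ∀ {x} → m ≤ x → x ≤ suc m → m ≡ x ⊎ suc m ≡ x
  close m≤x x≤1+m with ℕ.m≤n⇒m<n∨m≡n m≤x
  ... | inj₁ m<x = inj₂ (ℕ.≤-antisym m<x x≤1+m)
  ... | inj₂ eq  = inj₁ eq
...   | inj₂ (x , ys , x≰ , q) with ℕ.≰⇒> x≰
...     | s≤s {n = a} m<a = inj₂ (a ∷ suc m ∷ ys , separations-smooth (separations-↭ perm v) ,
            subst (_< Z (a ∷ suc m ∷ ys)) (sym (Z-↭ perm)) (Z-smooth ys m<a))
  where
  perm : k ∷ ks ↭ suc a ∷ m ∷ ys
  perm = ↭-trans p (↭-trans (↭-prep m q) (↭-swap m (suc a) ↭-refl))

occurrences-↭ : ∀ x {xs ys} → xs ↭ ys → occurrences x xs ≡ occurrences x ys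
occurrences-↭ x p = ↭-length (filter-↭ (ℕ._≟ x) p)

occurrences-here : ∀ x xs → occurrences x (x ∷ xs) ≡ suc (occurrences x xs)
occurrences-here x xs = cong length (filter-accept (ℕ._≟ x) refl)

occurrences-there : ∀ {x y} xs → y ≢ x → occurrences x (y ∷ xs) ≡ occurrences x xs
occurrences-there {x} xs y≢x = cong length (filter-reject (ℕ._≟ x) y≢x)

occurrences-suc : ∀ x xs → occurrences (suc x) (map suc xs) ≡ occurrences x xs
occurrences-suc x []       = refl
occurrences-suc x (y ∷ xs) = by-cases (y ℕ.≟ x)
  where
  by-cases : Dec (y ≡ x) → occurrences (suc x) (map suc (y ∷ xs)) ≡ occurrences x (y ∷ xs)
  by-cases (yes refl) = trans (occurrences-here (suc y) (map suc xs))
                   (trans (cong suc (occurrences-suc y xs)) (sym (occurrences-here y xs)))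
  by-cases (no y≢x) = trans (occurrences-there (map suc xs) (y≢x ∘ suc-injective))
                   (trans (occurrences-suc x xs) (sym (occurrences-there xs y≢x)))

module TwoValues {u v : ℕ} (u≢v : u ≢ v) where

  Either : ℕ → Set
  Either x = v ≡ x ⊎ u ≡ x

  data Compare (x : ℕ) : Set where
    is-u    : u ≡ x → Compare x
    is-v    : v ≡ x → Compare x
    neither : x ≢ u → x ≢ v → Compare x

  compare : ∀ x → Compare x
  compare x with x ℕ.≟ u | x ℕ.≟ v
  ... | yes x≡u | _       = is-u (sym x≡u)
  ... | no _    | yes x≡v = is-v (sym x≡v)
  ... | no x≢u  | no x≢v  = neither x≢u x≢v

  both-occurrences : List ℕ → ℕ
  both-occurrences xs = occurrences u xs + occurrences v xs

  both-u : ∀ xs → both-occurrences (u ∷ xs) ≡ suc (both-occurrences xs)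
  both-u xs = cong₂ _+_ (occurrences-here u xs) (occurrences-there xs u≢v)

  both-v : ∀ xs → both-occurrences (v ∷ xs) ≡ suc (both-occurrences xs)
  both-v xs = trans (cong₂ _+_ (occurrences-there xs (u≢v ∘ sym)) (occurrences-here v xs)) (+-suc _ _)

  both-neither : ∀ {x} xs → x ≢ u → x ≢ v → both-occurrences (x ∷ xs) ≡ both-occurrences xs
  both-neither xs x≢u x≢v = cong₂ _+_ (occurrences-there xs x≢u) (occurrences-there xs x≢v)

  both-≤ : ∀ xs → both-occurrences xs ≤ length xs
  both-≤ [] = z≤n
  both-≤ (x ∷ xs) with compare x
  ... | is-u refl = subst (_≤ suc (length xs)) (sym (both-u xs)) (s≤s (both-≤ xs))
  ... | is-v refl = subst (_≤ suc (length xs)) (sym (both-v xs)) (s≤s (both-≤ xs))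
  ... | neither x≢u x≢v = subst (_≤ suc (length xs)) (sym (both-neither xs x≢u x≢v)) (ℕ.m≤n⇒m≤1+n (both-≤ xs))

  both-full : ∀ xs → both-occurrences xs ≡ length xs → All Either xs
  both-full [] _ = []
  both-full (x ∷ xs) eq with compare x
  ... | is-u refl = inj₂ refl ∷ both-full xs (suc-injective (trans (sym (both-u xs)) eq))
  ... | is-v refl = inj₁ refl ∷ both-full xs (suc-injective (trans (sym (both-v xs)) eq))
  ... | neither x≢u x≢v =
    contradiction (both-≤ xs) (ℕ.<⇒≱ (ℕ.≤-reflexive (trans (sym eq) (both-neither xs x≢u x≢v))))

  both-either : ∀ {xs} → All Either xs → both-occurrences xs ≡ length xs
  both-either [] = refl
  both-either (inj₁ refl ∷ es) = trans (both-v _) (cong suc (both-either es))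
  both-either (inj₂ refl ∷ es) = trans (both-u _) (cong suc (both-either es))

  sort : ∀ {xs} → All Either xs → xs ↭ replicate (occurrences u xs) u ++ replicate (occurrences v xs) v
  sort [] = ↭-refl
  sort {_ ∷ xs} (inj₂ refl ∷ es)
    rewrite occurrences-here u xs | occurrences-there xs u≢v = ↭-prep u (sort es)
  sort {_ ∷ xs} (inj₁ refl ∷ es)
    rewrite occurrences-here v xs | occurrences-there xs (u≢v ∘ sym) =
    ↭-trans (↭-prep v (sort es)) (↭-sym (shift v (replicate (occurrences u xs) u) _))

quotient-unique : ∀ {r} a b {c d} → c < r → d < r → a * r + c ≡ b * r + d → a ≡ b × c ≡ d
quotient-unique {r} a b c<r d<r eq with ℕ.<-cmp a b
... | tri≈ _ refl _ = refl , ℕ.+-cancelˡ-≡ (a * r) _ _ eq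
... | tri< a<b _ _ = contradiction eq (ℕ.<⇒≢ (below a<b c<r))
  where
  below : ∀ {a b c d} → a < b → c < r → a * r + c < b * r + d
  below {a} {b} {c} {d} a<b c<r = begin-strict
    a * r + c <⟨ ℕ.+-monoʳ-< (a * r) c<r ⟩
    a * r + r ≡⟨ +-comm (a * r) r ⟩
    suc a * r ≤⟨ ℕ.*-monoˡ-≤ r a<b ⟩
    b * r     ≤⟨ ℕ.m≤m+n (b * r) d ⟩
    b * r + d ∎
    where open ℕ.≤-Reasoning
... | tri> _ _ b<a = contradiction (sym eq) (ℕ.<⇒≢ (ℕ.<-≤-trans (ℕ.+-monoʳ-< (b * r) d<r)
  (≤-trans (ℕ.≤-reflexive (+-comm (b * r) r)) (≤-trans (ℕ.*-monoˡ-≤ r b<a) (ℕ.m≤m+n _ _)))))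

total-replicate : ∀ s t u v → total (replicate s u ++ replicate t v) ≡ s * suc u + t * suc v
total-replicate zero    zero    u v = refl
total-replicate zero    (suc t) u v = cong (suc v +_) (total-replicate zero t u v)
total-replicate (suc s) t       u v =
  trans (cong (suc u +_) (total-replicate s t u v)) (sym (+-assoc (suc u) _ _))

total-zeros : ∀ n → total (replicate n 0) ≡ n
total-zeros zero    = refl
total-zeros (suc n) = cong suc (total-zeros n)

module Maximum (N r p s : ℕ) (r≥1 : 1 ≤ r) (N≡ : N ≡ suc p * r + s) (s<r : s < r) where

  open TwoValues {suc p} {p} (λ ()) using (both-full; sort)

  Even : List ℕ → Set
  Even ks = occurrences (suc p) ks ≡ s × occurrences p ks ≡ r ∸ s

  evenly : List ℕ
  evenly = replicate s (suc p) ++ replicate (r ∸ s) p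

  private
    s+[r∸s]≡r : s + (r ∸ s) ≡ r
    s+[r∸s]≡r = ℕ.m+[n∸m]≡n (ℕ.<⇒≤ s<r)

  total-split : ∀ c d m → c * suc (suc m) + d * suc m ≡ suc m * (c + d) + c
  total-split = solve-∀

  evenly-valid : Separations N r evenly
  evenly-valid = record
    { count = trans (length-++ (replicate s (suc p)))
                (trans (cong₂ _+_ (length-replicate s) (length-replicate (r ∸ s))) s+[r∸s]≡r)
    ; fill  = trans (total-replicate s (r ∸ s) (suc p) p) (trans (total-split s (r ∸ s) p)
                (trans (cong (λ x → suc p * x + s) s+[r∸s]≡r) (sym N≡))) }

  even⇒Z : ∀ {ks} → Separations N r ks → Even ks → Z ks ≡ Z evenly
  even⇒Z {ks} v (a , b) = Z-↭ (subst (ks ↭_) (cong₂ (λ x y → replicate x (suc p) ++ replicate y p) a b)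
    (sort (both-full ks (trans (cong₂ _+_ a b) (trans s+[r∸s]≡r (sym (Separations.count v)))))))

  -- Since `m` itself occurs, `suc m` occurs `c < r` times, and N = (m + 1) r + c is a division with
  -- remainder. Its uniqueness forces `m ≡ p` and `c ≡ s`.
  balanced⇒even : ∀ {ks} → Separations N r ks → Balanced ks → Even ks
  balanced⇒even {ks} v (m , ls , perm , near) =
    subst (λ n → occurrences (suc n) ks ≡ s) m≡p c≡s ,
    subst (λ n → occurrences n ks ≡ r ∸ s) m≡p
      (trans (sym (ℕ.m+n∸m≡n c d)) (cong₂ _∸_ c+d≡r c≡s))
    where
    module M = TwoValues {suc m} {m} (λ ())
    c = occurrences (suc m) ks
    d = occurrences m ks
    either : All M.Either ks
    either = All-resp-↭ (↭-sym perm) (inj₁ refl ∷ near)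
    c+d≡r : c + d ≡ r
    c+d≡r = trans (M.both-either either) (Separations.count v)
    c<r : c < r
    c<r = subst (c <_) c+d≡r (ℕ.m<m+n c (subst (0 <_)
      (sym (trans (occurrences-↭ m perm) (occurrences-here m ls))) (s≤s z≤n)))
    divided : suc m * r + c ≡ suc p * r + s
    divided = begin
      suc m * r + c           ≡⟨ cong (λ x → suc m * x + c) c+d≡r ⟨
      suc m * (c + d) + c     ≡⟨ total-split c d m ⟨
      c * suc (suc m) + d * suc m ≡⟨ total-replicate c d (suc m) m ⟨
      total (replicate c (suc m) ++ replicate d m) ≡⟨ total-↭ (M.sort either) ⟨
      total ks                ≡⟨ Separations.fill v ⟩
      N                       ≡⟨ N≡ ⟩
      suc p * r + s           ∎
      where open ≡-Reasoning
    m≡p : m ≡ p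
    m≡p = suc-injective (proj₁ (quotient-unique (suc m) (suc p) c<r s<r divided))
    c≡s : c ≡ s
    c≡s = proj₂ (quotient-unique (suc m) (suc p) c<r s<r divided)

  -- Every improvement raises `Z` by at least 1, so the bound `B` limits the number of improvements;
  -- the climb can only stop at a balanced sequence.
  even-maximal : ∀ {B} → (∀ {ks} → Separations N r ks → Z ks ≤ B) →
                 ∀ {ks} → Separations N r ks → Z ks ≤ Z evenly
  even-maximal {B} bound {ks} = climb B ks (ℕ.m≤m+n B _)
    where
    climb : ∀ fuel ks → B ≤ fuel + Z ks → Separations N r ks → Z ks ≤ Z evenly
    climb fuel ks le v with balanced-or-improvable r≥1 ks v
    ... | inj₁ balanced = ℕ.≤-reflexive (even⇒Z v (balanced⇒even v balanced))
    climb zero       ks le v | inj₂ (ls , v′ , lt) = contradiction (bound v′) (ℕ.<⇒≱ (ℕ.≤-<-trans le lt))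
    climb (suc fuel) ks le v | inj₂ (ls , v′ , lt) = ≤-trans (ℕ.<⇒≤ lt)
      (climb fuel ls (≤-trans le (≤-trans (ℕ.≤-reflexive (sym (+-suc fuel (Z ks)))) (ℕ.+-monoʳ-≤ fuel lt))) v′)

one-is-here : ∀ {x y xs} → All (y ≡_) xs → OneIs-RestAre x y (x ∷ xs)
one-is-here {xs = xs} ps = zero , refl , λ
  { zero    j≢ → contradiction refl j≢
  ; (suc j) _  → sym (All.lookup ps (∈-lookup j)) }

one-is-there : ∀ {x y xs} → OneIs-RestAre x y xs → OneIs-RestAre x y (y ∷ xs)
one-is-there (i , eq , rest) = suc i , eq , λ
  { zero    _  → refl
  ; (suc j) j≢ → rest j (j≢ ∘ cong suc) }

one-is-↭ : ∀ {x y} xs → OneIs-RestAre x y xs → xs ↭ x ∷ replicate (length xs ∸ 1) y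
one-is-↭ (z ∷ xs) (zero , refl , rest) =
  ↭-prep z (Perm.↭-reflexive (constant xs λ j → rest (suc j) λ ()))
  where
  constant : ∀ {y} xs → (∀ j → lookup xs j ≡ y) → xs ≡ replicate (length xs) y
  constant []       h = refl
  constant (x ∷ xs) h = cong₂ _∷_ (h zero) (constant xs (h ∘ suc))
one-is-↭ {x} {y} (z ∷ w ∷ xs) (suc i , eq , rest) =
  subst (λ z → z ∷ w ∷ xs ↭ x ∷ y ∷ replicate (length xs) y) (sym (rest zero λ ()))
    (↭-trans (↭-prep y (one-is-↭ (w ∷ xs) (i , eq , λ j j≢ → rest (suc j) (j≢ ∘ Fin.suc-injective))))
             (↭-swap y x ↭-refl))

module Minimum (N r : ℕ) (r≥1 : 1 ≤ r) where

  -- The large entry is left open here, because the total determines it. It may be 0, namely when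
  -- all intervals are 1.
  Concentrated : List ℕ → Set
  Concentrated ks = ∃ λ x → OneIs-RestAre (suc x) 1 (map suc ks)

  concentrated-or-improvable : ∀ ks → Separations N r ks →
    Concentrated ks ⊎ ∃ λ ls → Separations N r ls × Z ls < Z ks
  concentrated-or-improvable [] v =
    contradiction r≥1 (ℕ.<⇒≱ (ℕ.≤-reflexive (cong suc (sym (Separations.count v)))))
  concentrated-or-improvable (k ∷ ks) v with find k ks
    where
    find : ∀ k ks → Concentrated (k ∷ ks) ⊎
           ∃ λ a → ∃ λ b → ∃ λ ls → (k ∷ ks ↭ suc a ∷ suc b ∷ ls) × b ≤ a
    find zero []       = inj₁ (0 , one-is-here [])
    find zero (k ∷ ks) with find k ks
    ... | inj₁ (x , one) = inj₁ (x , one-is-there one)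
    ... | inj₂ (a , b , ls , p , le) =
      inj₂ (a , b , 0 ∷ ls , ↭-trans (↭-prep 0 p) (↭-sym (shift 0 (suc a ∷ suc b ∷ []) ls)) , le)
    find (suc a) ks with all-or-extract (0 ℕ.≟_) ks
    ... | inj₁ zeros = inj₁ (suc a , one-is-here (All.map⁺ (All.map (cong suc) zeros)))
    ... | inj₂ (zero  , _  , ≢0 , _) = contradiction refl ≢0
    ... | inj₂ (suc b , ls , _  , p) with ℕ.≤-total b a
    ...   | inj₁ b≤a = inj₂ (a , b , ls , ↭-prep (suc a) p , b≤a)
    ...   | inj₂ a≤b = inj₂ (b , a , ls , ↭-trans (↭-prep (suc a) p) (↭-swap (suc a) (suc b) ↭-refl) , a≤b)
  ... | inj₁ c = inj₁ c
  -- One unit moves from the smaller of two positive entries to the larger. Read backwards this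
  -- smooths `suc (suc a)` and `b`, which differ by at least 2, so `Z` drops.
  ... | inj₂ (a , b , ls , p , b≤a) = inj₂ (suc (suc a) ∷ b ∷ ls , separations-rough (separations-↭ p v) ,
    subst (Z (suc (suc a) ∷ b ∷ ls) <_) (sym (Z-↭ p)) (Z-smooth ls (s≤s b≤a)))

  lopsided : List ℕ
  lopsided = (N ∸ r) ∷ replicate (r ∸ 1) 0

  concentrated-value : ∀ {x ks} → Separations N r ks → OneIs-RestAre (suc x) 1 (map suc ks) →
                       x ≡ N ∸ r × Z ks ≡ Z lopsided
  concentrated-value {x} {ks} v one = x≡N∸r , trans (Z-↭ perm) (cong (λ y → Z (y ∷ replicate (r ∸ 1) 0)) x≡N∸r)
    where
    perm′ : map suc ks ↭ suc x ∷ replicate (r ∸ 1) 1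
    perm′ = subst (λ n → map suc ks ↭ suc x ∷ replicate (n ∸ 1) 1)
      (trans (length-map suc ks) (Separations.count v)) (one-is-↭ (map suc ks) one)
    perm : ks ↭ x ∷ replicate (r ∸ 1) 0
    perm = subst (_↭ x ∷ replicate (r ∸ 1) 0) (trans (sym (map-∘ ks)) (map-id ks))
      (subst (map pred (map suc ks) ↭_) (cong (x ∷_) (map-replicate pred (r ∸ 1) 1)) (map⁺ pred perm′))
    x≡N∸r : x ≡ N ∸ r
    x≡N∸r = begin
      x                             ≡⟨ ℕ.m+n∸n≡m x r ⟨
      (x + r) ∸ r                   ≡⟨ cong (λ y → (x + y) ∸ r) (ℕ.m+[n∸m]≡n r≥1) ⟨
      (x + suc (r ∸ 1)) ∸ r         ≡⟨ cong (_∸ r) (+-suc x (r ∸ 1)) ⟩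
      suc (x + (r ∸ 1)) ∸ r         ≡⟨ cong (λ y → suc (x + y) ∸ r) (total-zeros (r ∸ 1)) ⟨
      total (x ∷ replicate (r ∸ 1) 0) ∸ r ≡⟨ cong (_∸ r) (total-↭ perm) ⟨
      total ks ∸ r                  ≡⟨ cong (_∸ r) (Separations.fill v) ⟩
      N ∸ r                         ∎
      where open ≡-Reasoning

  lopsided-minimal : ∀ {ks} → Separations N r ks → Z lopsided ≤ Z ks
  lopsided-minimal {ks} = descend (Z ks) ks ≤-refl
    where
    descend : ∀ fuel ks → Z ks ≤ fuel → Separations N r ks → Z lopsided ≤ Z ks
    descend fuel ks le v with concentrated-or-improvable ks v
    ... | inj₁ (x , one) = ℕ.≤-reflexive (sym (proj₂ (concentrated-value v one)))
    descend zero       ks le v | inj₂ (ls , v′ , lt) = contradiction (ℕ.<-≤-trans lt le) λ ()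
    descend (suc fuel) ks le v | inj₂ (ls , v′ , lt) =
      ≤-trans (descend fuel ls (ℕ.s≤s⁻¹ (ℕ.<-≤-trans lt le)) v′) (ℕ.<⇒≤ lt)

  lopsided-valid : r ≤ N → Separations N r lopsided
  lopsided-valid r≤N = record
    { count = trans (cong suc (length-replicate (r ∸ 1))) (ℕ.m+[n∸m]≡n r≥1)
    ; fill  = begin
        suc (N ∸ r) + total (replicate (r ∸ 1) 0) ≡⟨ cong (suc (N ∸ r) +_) (total-zeros (r ∸ 1)) ⟩
        suc (N ∸ r) + (r ∸ 1)   ≡⟨ +-suc (N ∸ r) (r ∸ 1) ⟨
        (N ∸ r) + suc (r ∸ 1)   ≡⟨ cong ((N ∸ r) +_) (ℕ.m+[n∸m]≡n r≥1) ⟩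
        (N ∸ r) + r             ≡⟨ ℕ.m∸n+n≡m r≤N ⟩
        N                       ∎ }
    where
    open ≡-Reasoning

-- Values and extremes

double-suc : ∀ k → 2 * suc k ≡ suc (suc (2 * k))
double-suc k = cong suc (+-suc k (k + 0))

F-even : ∀ k → F (2 * k) ≡ even k
F-odd  : ∀ k → F (suc (2 * k)) ≡ odd k
F-even zero    = refl
F-even (suc k) = trans (cong F (double-suc k)) (trans (cong₂ _+_ (F-odd k) (F-even k)) (+-comm (odd k) (even k)))
F-odd zero    = refl
F-odd (suc k) = trans (cong (F ∘ suc) (double-suc k))
  (cong₂ _+_ (trans (cong F (sym (double-suc k))) (F-even (suc k))) (F-odd k))

L-F : ∀ n → L (suc n) ≡ F n + F (suc (suc n))
L-F zero          = refl
L-F (suc zero)    = refl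
L-F (suc (suc n)) = trans (cong₂ _+_ (L-F (suc n)) (L-F n)) (+-interchange (F (suc n)) _ (F n) _)

L-γ : ∀ k → L (2 * suc k) ≡ γ k + 2
L-γ k = begin
  L (2 * suc k)                            ≡⟨ cong L (double-suc k) ⟩
  L (suc (suc (2 * k)))                    ≡⟨ L-F (suc (2 * k)) ⟩
  F (suc (2 * k)) + F (suc (suc (suc (2 * k)))) ≡⟨ cong (λ n → F (suc (2 * k)) + F (suc n)) (double-suc k) ⟨
  F (suc (2 * k)) + F (suc (2 * suc k))    ≡⟨ cong₂ _+_ (F-odd k) (F-odd (suc k)) ⟩
  odd k + odd (suc k)                      ≡⟨ γ-lucas k ⟨
  γ k + 2                                  ∎
  where open ≡-Reasoning

L⊖2 : ∀ k → L (2 * suc k) ⊖ 2 ≡ ℤ.+ γ k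
L⊖2 k = trans (cong (_⊖ 2) (L-γ k)) (trans (ℤ.⊖-≥ (ℕ.m≤n+m 2 (γ k))) (cong ℤ.+_ (ℕ.m+n∸n≡m (γ k) 2)))

Z-lopsided : ∀ k n → Z (k ∷ replicate n 0) ≡ γ k + n * φ k
Z-lopsided k n = trans (cong₂ (λ x y → γ k * x + φ k * y) (∏φ-zeros n) (Z-zeros n)) (shuffle (γ k) (φ k) n)
  where
  ∏φ-zeros : ∀ n → ∏φ (replicate n 0) ≡ 1
  ∏φ-zeros zero    = refl
  ∏φ-zeros (suc n) = trans (+-identityʳ _) (∏φ-zeros n)
  Z-zeros : ∀ n → Z (replicate n 0) ≡ n
  Z-zeros zero    = refl
  Z-zeros (suc n) = cong₂ _+_ (trans (+-identityʳ _) (∏φ-zeros n)) (trans (+-identityʳ _) (Z-zeros n))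
  shuffle : ∀ g f n → g * 1 + f * n ≡ g + n * f
  shuffle = solve-∀

∏φ-replicate : ∀ s t u v → ∏φ (replicate s u ++ replicate t v) ≡ φ u ^ s * φ v ^ t
∏φ-replicate zero    zero    u v = refl
∏φ-replicate zero    (suc t) u v = trans (cong (φ v *_) (∏φ-replicate zero t u v)) (shuffle (φ v) (φ v ^ t))
  where
  shuffle : ∀ x y → x * (1 * y) ≡ 1 * (x * y)
  shuffle = solve-∀
∏φ-replicate (suc s) t       u v =
  trans (cong (φ u *_) (∏φ-replicate s t u v)) (sym (*-assoc (φ u) _ _))

-- The denominators of the summands γ/φ are cleared.
Z-replicate : ∀ s t u v → Z (replicate s u ++ replicate t v) * (φ u * φ v) ≡
              (φ u ^ s * φ v ^ t) * (s * γ u * φ v + t * γ v * φ u)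
Z-replicate zero zero u v = refl
Z-replicate zero (suc t) u v = begin
  (γ v * ∏φ ks + φ v * Z ks) * (φ u * φ v)
    ≡⟨ split (γ v) (φ v) (φ u) (∏φ ks) (Z ks) ⟩
  γ v * ∏φ ks * (φ u * φ v) + φ v * (Z ks * (φ u * φ v))
    ≡⟨ cong₂ (λ x y → γ v * x * (φ u * φ v) + φ v * y) (∏φ-replicate zero t u v) (Z-replicate zero t u v) ⟩
  γ v * (1 * φ v ^ t) * (φ u * φ v) + φ v * ((1 * φ v ^ t) * (0 * γ u * φ v + t * γ v * φ u))
    ≡⟨ collect (γ u) (γ v) (φ u) (φ v) t (φ v ^ t) ⟩
  (1 * (φ v * φ v ^ t)) * (0 * γ u * φ v + (1 + t) * γ v * φ u) ∎
  where
  open ≡-Reasoning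
  ks = replicate t v
  split : ∀ g f f′ p z → (g * p + f * z) * (f′ * f) ≡ g * p * (f′ * f) + f * (z * (f′ * f))
  split = solve-∀
  collect : ∀ gu gv fu fv t y → gv * (1 * y) * (fu * fv) + fv * ((1 * y) * (0 * gu * fv + t * gv * fu)) ≡
                                (1 * (fv * y)) * (0 * gu * fv + (1 + t) * gv * fu)
  collect = solve-∀
Z-replicate (suc s) t u v = begin
  (γ u * ∏φ ks + φ u * Z ks) * (φ u * φ v)
    ≡⟨ split (γ u) (φ u) (φ v) (∏φ ks) (Z ks) ⟩
  γ u * ∏φ ks * (φ u * φ v) + φ u * (Z ks * (φ u * φ v))
    ≡⟨ cong₂ (λ x y → γ u * x * (φ u * φ v) + φ u * y) (∏φ-replicate s t u v) (Z-replicate s t u v) ⟩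
  γ u * (φ u ^ s * φ v ^ t) * (φ u * φ v) + φ u * ((φ u ^ s * φ v ^ t) * (s * γ u * φ v + t * γ v * φ u))
    ≡⟨ collect (γ u) (γ v) (φ u) (φ v) s t (φ u ^ s) (φ v ^ t) ⟩
  ((φ u * φ u ^ s) * φ v ^ t) * ((1 + s) * γ u * φ v + t * γ v * φ u) ∎
  where
  open ≡-Reasoning
  ks = replicate s u ++ replicate t v
  split : ∀ g f f′ p z → (g * p + f * z) * (f * f′) ≡ g * p * (f * f′) + f * (z * (f * f′))
  split = solve-∀
  collect : ∀ gu gv fu fv s t x y →
    gu * (x * y) * (fu * fv) + fu * ((x * y) * (s * gu * fv + t * gv * fu)) ≡
    ((fu * x) * y) * ((1 + s) * gu * fv + t * gv * fu)
  collect = solve-∀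

/-cong : ∀ {i j m n} .{{_ : NonZero m}} .{{_ : NonZero n}} → i ≡ j → m ≡ n → i / m ≡ j / n
/-cong refl refl = refl

-- For unnormalised fractions equality is cross-multiplication, and all denominators are explicit
-- products of `1`, `f₁` and `f₂`, so the equation between natural numbers decides it.
clear-denominators : ∀ x P s t g₁ g₂ f₁ f₂ .{{_ : NonZero f₁}} .{{_ : NonZero f₂}} →
  x * (f₁ * f₂) ≡ P * (s * g₁ * f₂ + t * g₂ * f₁) →
  ℤ.+ x / 1 ≡ ℤ.+ P / 1 ℚ.* (ℤ.+ s / 1 ℚ.* (ℤ.+ g₁ / f₁) ℚ.+ ℤ.+ t / 1 ℚ.* (ℤ.+ g₂ / f₂))
clear-denominators x P s t g₁ g₂ f₁@(suc _) f₂@(suc _) eq = ℚ.toℚᵘ-injective (begin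
  ℚ.toℚᵘ (ℤ.+ x / 1)
    ≈⟨ as-fraction (ℤ.+ x) 1 ⟩
  (ℤ.+ x) ℚᵘ./ 1
    ≈⟨ ℚᵘ.*≡* cleared ⟩
  (ℤ.+ P) ℚᵘ./ 1 ℚᵘ.* ((ℤ.+ s) ℚᵘ./ 1 ℚᵘ.* ((ℤ.+ g₁) ℚᵘ./ f₁) ℚᵘ.+ (ℤ.+ t) ℚᵘ./ 1 ℚᵘ.* ((ℤ.+ g₂) ℚᵘ./ f₂))
    ≈⟨ ℚᵘ.*-cong (as-fraction (ℤ.+ P) 1) (ℚᵘ.+-cong (scaled s g₁ f₁) (scaled t g₂ f₂)) ⟨
  ℚ.toℚᵘ (ℤ.+ P / 1) ℚᵘ.* (ℚ.toℚᵘ (ℤ.+ s / 1 ℚ.* (ℤ.+ g₁ / f₁)) ℚᵘ.+ ℚ.toℚᵘ (ℤ.+ t / 1 ℚ.* (ℤ.+ g₂ / f₂)))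
    ≈⟨ ℚᵘ.*-congˡ {ℚ.toℚᵘ (ℤ.+ P / 1)} (ℚ.toℚᵘ-homo-+ (ℤ.+ s / 1 ℚ.* (ℤ.+ g₁ / f₁)) _) ⟨
  ℚ.toℚᵘ (ℤ.+ P / 1) ℚᵘ.* ℚ.toℚᵘ (ℤ.+ s / 1 ℚ.* (ℤ.+ g₁ / f₁) ℚ.+ ℤ.+ t / 1 ℚ.* (ℤ.+ g₂ / f₂))
    ≈⟨ ℚ.toℚᵘ-homo-* (ℤ.+ P / 1) _ ⟨
  ℚ.toℚᵘ (ℤ.+ P / 1 ℚ.* (ℤ.+ s / 1 ℚ.* (ℤ.+ g₁ / f₁) ℚ.+ ℤ.+ t / 1 ℚ.* (ℤ.+ g₂ / f₂))) ∎)
  where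
  open ℚᵘ.≃-Reasoning
  as-fraction : ∀ i d .{{_ : NonZero d}} → ℚ.toℚᵘ (i / d) ℚᵘ.≃ i ℚᵘ./ d
  as-fraction i (suc d) = ℚ.toℚᵘ-fromℚᵘ (ℚᵘ.mkℚᵘ i d)
  scaled : ∀ s g f .{{_ : NonZero f}} →
    ℚ.toℚᵘ (ℤ.+ s / 1 ℚ.* (ℤ.+ g / f)) ℚᵘ.≃ (ℤ.+ s) ℚᵘ./ 1 ℚᵘ.* ((ℤ.+ g) ℚᵘ./ f)
  scaled s g f = ℚᵘ.≃-trans (ℚ.toℚᵘ-homo-* (ℤ.+ s / 1) (ℤ.+ g / f))
    (ℚᵘ.*-cong (as-fraction (ℤ.+ s) 1) (as-fraction (ℤ.+ g) f))
  summand : ∀ s g f → ℤ.+ (s * g * f) ≡ (ℤ.+ s ℤ.* ℤ.+ g) ℤ.* ℤ.+ f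
  summand s g f = trans (ℤ.pos-* (s * g) f) (cong (ℤ._* ℤ.+ f) (ℤ.pos-* s g))
  numerator : ∀ d₁ d₂ → ℤ.+ (P * (s * g₁ * d₂ + t * g₂ * d₁)) ≡
    ℤ.+ P ℤ.* ((ℤ.+ s ℤ.* ℤ.+ g₁) ℤ.* ℤ.+ d₂ ℤ.+ (ℤ.+ t ℤ.* ℤ.+ g₂) ℤ.* ℤ.+ d₁)
  numerator d₁ d₂ = trans (ℤ.pos-* P _) (cong (ℤ.+ P ℤ.*_) (cong₂ ℤ._+_ (summand s g₁ d₂) (summand t g₂ d₁)))
  cleared : ℤ.+ x ℤ.* ℤ.+ (1 * ((1 * f₁) * (1 * f₂))) ≡
    (ℤ.+ P ℤ.* ((ℤ.+ s ℤ.* ℤ.+ g₁) ℤ.* ℤ.+ (1 * f₂) ℤ.+ (ℤ.+ t ℤ.* ℤ.+ g₂) ℤ.* ℤ.+ (1 * f₁))) ℤ.* ℤ.+ 1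
  cleared = trans (sym (ℤ.pos-* x _))
    (trans (cong ℤ.+_ (trans (ones x f₁ f₂) (trans eq (ones′ P (s * g₁) (t * g₂) f₁ f₂))))
    (trans (numerator (1 * f₁) (1 * f₂)) (sym (ℤ.*-identityʳ _))))
    where
    ones : ∀ x a b → x * (1 * ((1 * a) * (1 * b))) ≡ x * (a * b)
    ones = solve-∀
    ones′ : ∀ P a b c d → P * (a * d + b * c) ≡ P * (a * (1 * d) + b * (1 * c))
    ones′ = solve-∀

maxValue-evenly : ∀ r p s .{{_ : NonZero (suc p)}} →
  ℤ.+ Z (replicate s (suc p) ++ replicate (r ∸ s) p) / 1 ≡ maxValue r (suc p) s
maxValue-evenly r p s = trans
  (clear-denominators (Z (replicate s (suc p) ++ replicate (r ∸ s) p))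
    (φ (suc p) ^ s * φ p ^ (r ∸ s)) s (r ∸ s) (γ (suc p)) (γ p) (φ (suc p)) (φ p)
    {{φ-nonZero (suc p)}} {{φ-nonZero p}} (Z-replicate s (r ∸ s) (suc p) p))
  (sym (cong₂ ℚ._*_
    (cong (λ n → ℤ.+ n / 1) (cong₂ (λ x y → x ^ s * y ^ (r ∸ s))
      (trans (cong (λ n → F (2 * n)) (+-comm (suc p) 1)) (F-even (suc (suc p))))
      (F-even (suc p))))
    (cong₂ (λ x y → ℤ.+ s / 1 ℚ.* x ℚ.+ ℤ.+ (r ∸ s) / 1 ℚ.* y)
      (ratio-φ (suc p) (+-comm (suc p) 1)) (ratio-φ p refl))))
  where
  φ-nonZero : ∀ k → NonZero (φ k)
  φ-nonZero k = ℕ.>-nonZero (even-positive k)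
  ratio-φ : ∀ k {n} .{{_ : NonZero n}} → n ≡ suc k → ratio n ≡ _/_ (ℤ.+ γ k) (φ k) {{φ-nonZero k}}
  ratio-φ k refl = /-cong {{F2-nonZero (suc k)}} {{φ-nonZero k}} (L⊖2 k) (F-even (suc k))

minValue-lopsided : ∀ N r → ℤ.+ Z ((N ∸ r) ∷ replicate (r ∸ 1) 0) / 1 ≡ minValue N r
minValue-lopsided N r = cong (_/ 1) (trans (cong ℤ.+_ (Z-lopsided k (r ∸ 1)))
  (sym (cong₂ (λ x y → x ℤ.+ ℤ.+ ((r ∸ 1) * y))
    (trans (cong (λ n → L (2 * n) ⊖ 2) (+-comm k 1)) (L⊖2 k))
    (trans (cong (λ n → F (2 * n)) (+-comm k 1)) (F-even (suc k))))))
  where k = N ∸ r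

ℱ-bounded : ∀ G R → ℱ G R ≤ length (allSubsets (Graph.size G))
ℱ-bounded G R = length-filter (rootedSpanningForest? G R) (allSubsets (Graph.size G))

-- Of `f` only its values on sets of size `r` and a bound matter. Every valid sequence is realised
-- by some set, so extremality among sets and among sequences coincide, and the bound passes to `Z`.
module Extremes (N r : ℕ) (r≥1 : 1 ≤ r) (f : Subset N → ℕ)
  (value : ∀ R → ∣ R ∣ ≡ r → f R ≡ Z (separations (Vec.toList R)))
  {B : ℕ} (f≤B : ∀ R → f R ≤ B) where

  private
    HasSizeR : Subset N → Set
    HasSizeR R = ∣ R ∣ ≡ r

    sep : Subset N → List ℕ
    sep = separations ∘ Vec.toList

    valid : ∀ R → ∣ R ∣ ≡ r → Separations N r (sep R)
    valid = separations-valid r≥1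

    realise : ∀ {ks} → Separations N r ks → ∃ λ R → ∣ R ∣ ≡ r × f R ≡ Z ks
    realise v = let R , size , eq = separations-surjective v in R , size , trans (value R size) (cong Z eq)

  Z-bounded : ∀ {ks} → Separations N r ks → Z ks ≤ B
  Z-bounded v = let R , _ , eq = realise v in ≤-trans (ℕ.≤-reflexive (sym eq)) (f≤B R)

  maximizes⁺ : ∀ R → ∣ R ∣ ≡ r → (∀ {ks} → Separations N r ks → Z ks ≤ Z (sep R)) → Maximizes HasSizeR f R
  maximizes⁺ R size max R′ size′ = begin
    f R′       ≡⟨ value R′ size′ ⟩
    Z (sep R′) ≤⟨ max (valid R′ size′) ⟩
    Z (sep R)  ≡⟨ value R size ⟨
    f R        ∎
    where open ℕ.≤-Reasoning

  maximizes⁻ : ∀ R → ∣ R ∣ ≡ r → Maximizes HasSizeR f R → ∀ {ks} → Separations N r ks → Z ks ≤ Z (sep R)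
  maximizes⁻ R size max v with realise v
  ... | R′ , size′ , eq = subst (_≤ Z (sep R)) eq (subst (f R′ ≤_) (value R size) (max R′ size′))

  minimizes⁺ : ∀ R → ∣ R ∣ ≡ r → (∀ {ks} → Separations N r ks → Z (sep R) ≤ Z ks) → Minimizes HasSizeR f R
  minimizes⁺ R size min R′ size′ = begin
    f R        ≡⟨ value R size ⟩
    Z (sep R)  ≤⟨ min (valid R′ size′) ⟩
    Z (sep R′) ≡⟨ value R′ size′ ⟨
    f R′       ∎
    where open ℕ.≤-Reasoning

  minimizes⁻ : ∀ R → ∣ R ∣ ≡ r → Minimizes HasSizeR f R → ∀ {ks} → Separations N r ks → Z (sep R) ≤ Z ks
  minimizes⁻ R size min v with realise v
  ... | R′ , size′ , eq = subst (Z (sep R) ≤_) eq (subst (_≤ f R′) (value R size) (min R′ size′))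

  isMaximum : ∀ {ks m} → Separations N r ks → (∀ {ls} → Separations N r ls → Z ls ≤ Z ks) →
              ℤ.+ Z ks / 1 ≡ m → IsMaximum HasSizeR f m
  isMaximum v max eq with separations-surjective v
  ... | R , size , refl = R , size , maximizes⁺ R size max , trans (cong (λ n → ℤ.+ n / 1) (value R size)) eq

  isMinimum : ∀ {ks m} → Separations N r ks → (∀ {ls} → Separations N r ls → Z ks ≤ Z ls) →
              ℤ.+ Z ks / 1 ≡ m → IsMinimum HasSizeR f m
  isMinimum v min eq with separations-surjective v
  ... | R , size , refl = R , size , minimizes⁺ R size min , trans (cong (λ n → ℤ.+ n / 1) (value R size)) eq

  occurrences-intervals : ∀ (R : Subset N) x → occurrences (suc x) (cyclicIntervals R) ≡ occurrences x (sep R)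
  occurrences-intervals R x =
    trans (cong (occurrences (suc x)) (cyclicIntervals-separations R)) (occurrences-suc x (sep R))

  module _ (p s : ℕ) (N≡ : N ≡ suc p * r + s) (s<r : s < r) where
    open Maximum N r p s r≥1 N≡ s<r

    private
      maximal : ∀ {ks} → Separations N r ks → Z ks ≤ Z evenly
      maximal = even-maximal Z-bounded

    maximizes⇔even : ∀ R → ∣ R ∣ ≡ r → Maximizes HasSizeR f R ⇔
      (occurrences (suc p + 1) (cyclicIntervals R) ≡ s × occurrences (suc p) (cyclicIntervals R) ≡ r ∸ s)
    maximizes⇔even R size = mk⇔ to from
      where
      upper : occurrences (suc p + 1) (cyclicIntervals R) ≡ occurrences (suc p) (sep R)
      upper = trans (occurrences-intervals R (p + 1)) (cong (λ n → occurrences n (sep R)) (+-comm p 1))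
      to : Maximizes HasSizeR f R → occurrences (suc p + 1) (cyclicIntervals R) ≡ s ×
           occurrences (suc p) (cyclicIntervals R) ≡ r ∸ s
      to max with balanced-or-improvable r≥1 (sep R) (valid R size)
      -- A maximizer admits no improvement; this is where strict smoothing yields the shape of `R`.
      ... | inj₂ (ls , v , lt) = contradiction (maximizes⁻ R size max v) (ℕ.<⇒≱ lt)
      ... | inj₁ balanced with balanced⇒even (valid R size) balanced
      ...   | a , b = trans upper a , trans (occurrences-intervals R p) b
      from : occurrences (suc p + 1) (cyclicIntervals R) ≡ s ×
             occurrences (suc p) (cyclicIntervals R) ≡ r ∸ s → Maximizes HasSizeR f R
      from (a , b) = maximizes⁺ R size λ v → ≤-trans (maximal v) (ℕ.≤-reflexive (sym (even⇒Z (valid R size)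
        (trans (sym upper) a , trans (sym (occurrences-intervals R p)) b))))

    maximum : IsMaximum HasSizeR f (maxValue r (suc p) s)
    maximum = isMaximum evenly-valid maximal (maxValue-evenly r p s)

  open Minimum N r r≥1

  minimizes⇔lopsided : ∀ R → ∣ R ∣ ≡ r → Minimizes HasSizeR f R ⇔
    OneIs-RestAre (N ∸ r + 1) 1 (cyclicIntervals R)
  minimizes⇔lopsided R size = mk⇔ to from
    where
    to : Minimizes HasSizeR f R → OneIs-RestAre (N ∸ r + 1) 1 (cyclicIntervals R)
    to min with concentrated-or-improvable (sep R) (valid R size)
    ... | inj₂ (ls , v , lt) = contradiction (minimizes⁻ R size min v) (ℕ.<⇒≱ lt)
    ... | inj₁ (x , one) = subst (λ xs → OneIs-RestAre (N ∸ r + 1) 1 xs) (sym (cyclicIntervals-separations R))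
      (subst (λ y → OneIs-RestAre y 1 (map suc (sep R)))
             (trans (cong suc (proj₁ (concentrated-value (valid R size) one))) (+-comm 1 (N ∸ r))) one)
    from : OneIs-RestAre (N ∸ r + 1) 1 (cyclicIntervals R) → Minimizes HasSizeR f R
    from one = minimizes⁺ R size λ v → ≤-trans
      (ℕ.≤-reflexive (proj₂ (concentrated-value (valid R size) (subst (λ y → OneIs-RestAre y 1 (map suc (sep R)))
        (+-comm (N ∸ r) 1) (subst (λ xs → OneIs-RestAre (N ∸ r + 1) 1 xs) (cyclicIntervals-separations R) one)))))
      (lopsided-minimal v)

  minimum : r ≤ N → IsMinimum HasSizeR f (minValue N r)
  minimum r≤N = isMinimum (lopsided-valid r≤N) lopsided-minimal (minValue-lopsided N r)

theorem5p2 :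
  (N r q s : ℕ) (N≥3 : 3 ≤ N) → 1 ≤ r → (r≤N : r ≤ N) →
  (N≡qr+s : N ≡ q * r + s) (s<r : s < r) →
  let HasSizeR = λ (R : Subset N) → ∣ R ∣ ≡ r
      f        = ℱ-wheel N N≥3
  in
  (((R : Subset N) → ∣ R ∣ ≡ r →
      Maximizes HasSizeR f R ⇔
        (occurrences (q + 1) (cyclicIntervals R) ≡ s ×
         occurrences q (cyclicIntervals R) ≡ r ∸ s))
   × IsMaximum HasSizeR f (maxValue r q s {{quotient-nonZero r≤N N≡qr+s s<r}}))
  ×
  (((R : Subset N) → ∣ R ∣ ≡ r →
      Minimizes HasSizeR f R ⇔
        OneIs-RestAre (N ∸ r + 1) 1 (cyclicIntervals R))
   × IsMinimum HasSizeR f (minValue N r))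
theorem5p2 N r zero s N≥3 r≥1 r≤N N≡s s<r =
  contradiction r≤N (ℕ.<⇒≱ (subst (_< r) (sym N≡s) s<r))
theorem5p2 N r (suc p) s N≥3 r≥1 r≤N N≡qr+s s<r =
  (maximizes⇔even p s N≡qr+s s<r , maximum p s N≡qr+s s<r) ,
  (minimizes⇔lopsided , minimum r≤N)
  where
  open Extremes N r r≥1 (ℱ-wheel N N≥3) (ℱ-wheel-separations N≥3 r≥1)
    (λ R → ℱ-bounded (wheel N N≥3) (outside ∷ R))
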